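{- Let $n \geq 2$ and let $L_1, L_2 \subset \mathbb{R}^n$ be arbitrary lattices. Suppose that the group $\Gamma(L_1,L_2) \leq G$ is discrete. Then $\Gamma(L_1,L_2)$ is not the free inner product of $\Gamma_{\mathrm{upp}}(L_1)$ and $\Gamma_{\mathrm{low}}(L_2)$, i.e. the canonical homomorphism from the abstract free product $\Gamma_{\mathrm{upp}}(L_1) * \Gamma_{\mathrm{low}}(L_2)$ to $\Gamma(L_1,L_2)$ is not an isomorphism.
   Context: Lattices have full rank. $G = \mathrm{PSL}_2(\mathbb{R}^n) \cong \mathrm{PSL}_2(\mathbb{R})^n$, where $\mathbb{R}^n$ is a ring with componentwise operations, with its Lie group topology. For $x \in \mathbb{R}^n$ let $T^x = \begin{pmatrix}1 & x\\ 0 & 1\end{pmatrix}$, $V^x = \begin{pmatrix}1 & 0\\ x & 1\end{pmatrix} \in G$ (with $0=(0,\dots,0)$, $1=(1,\dots,1)$); in terms of $\mathrm{PSL}_2(\mathbb{R})^n$, the $j$-th components are the corresponding matrices with entry $x_j$. For lattices $L,L_1,L_2 \subset \mathbb{R}^n$: $\Gamma_{\mathrm{upp}}(L) = \{T^x : x \in L\}$, $\Gamma_{\mathrm{low}}(L) = \{V^y : y \in L\}$, and $\Gamma(L_1,L_2) \leq G$ is the subgroup generated by $\Gamma_{\mathrm{upp}}(L_1) \cup \Gamma_{\mathrm{low}}(L_2)$. -}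

module Defs where

open import Level using (Level; 0ℓ; _⊔_) renaming (suc to lsuc)
open import Algebra.Bundles using (Group; CommutativeRing)
open import Algebra.Morphism.Structures using (IsGroupHomomorphism; IsGroupIsomorphism)
import Algebra.Construct.Pointwise as Pointwise
import Algebra.Properties.Group as GroupProperties
import Algebra.Properties.Semiring.Sum as SemiringSum
import Algebra.Solver.Ring as RingSolver
open import Algebra.Solver.Ring.AlmostCommutativeRing using (fromCommutativeRing; _-Raw-AlmostCommutative⟶_)
open import Data.Fin.Base using (Fin)
open import Data.Integer.Base as ℤ using (ℤ)
import Data.Integer.Properties as ℤ
open import Data.List.Base using (List; []; _∷_; [_]; _++_; foldr)
import Data.List.Properties as List
open import Data.Nat.Base as ℕ using (ℕ)
import Data.Nat.Properties as ℕ
import Data.Maybe.Base as Maybe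
open import Data.Product.Base using (Σ; ∃; _×_; _,_; proj₁; proj₂)
open import Data.Rational.Base as ℚ using (ℚ; 0ℚ; 1ℚ; ½)
import Data.Rational.Properties as ℚ
import Data.Rational.Unnormalised.Base as ℚᵘ
open import Data.Rational.Solver using (module +-*-Solver)
open import Data.Sum.Base using (_⊎_; inj₁; inj₂)
open import Data.Vec.Functional using (Vector)
open import Function.Base using (_∘_)
open import Function.Bundles using (_⇔_; Equivalence)
open import Relation.Binary.Bundles using (Setoid)
open import Relation.Binary.Core using (Rel)
open import Relation.Binary.Definitions using (_Respects_)
open import Relation.Binary.PropositionalEquality as ≡ using (_≡_)
open import Relation.Nullary.Decidable.Core using (dec⇒maybe)
open import Relation.Unary using (Pred; _∈_; _∪_)
import Relation.Binary.Reasoning.Setoid as SetoidReasoning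

private
  module ℚ-estimates where
    open import Data.Rational.Base using (_+_; _*_; _-_; -_; ∣_∣; _<_; Positive; positive)

    half-pos : ∀ {ε} → 0ℚ < ε → 0ℚ < ½ * ε
    half-pos {ε} 0<ε = ℚ.positive⁻¹ (½ * ε) {{ℚ.pos*pos⇒pos ½ ε {{positive 0<ε}}}}

    halves : ∀ ε → ½ * ε + ½ * ε ≡ ε
    halves ε = ≡.trans (≡.sym (ℚ.*-distribʳ-+ ε ½ ½)) (ℚ.*-identityˡ ε)

    sum-small : ∀ {p q ε} → ∣ p ∣ < ½ * ε → ∣ q ∣ < ½ * ε → ∣ p + q ∣ < ε
    sum-small {p} {q} {ε} p< q< =
      ℚ.≤-<-trans (ℚ.∣p+q∣≤∣p∣+∣q∣ p q)
        (≡.subst (∣ p ∣ + ∣ q ∣ <_) (halves ε) (ℚ.+-mono-< p< q<))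

    shrink : ∀ {B ε} → 0ℚ < B → 0ℚ < ε → Σ ℚ λ δ → 0ℚ < δ × B * δ ≡ ε
    shrink {B} {ε} 0<B 0<ε = δ , ℚ.positive⁻¹ δ , eq
      where
      instance
        B-pos : Positive B
        B-pos = positive 0<B
        ε-pos : Positive ε
        ε-pos = positive 0<ε
        B-nz : ℚ.NonZero B
        B-nz = ℚ.pos⇒nonZero B
        B⁻¹-pos : Positive (ℚ.1/ B)
        B⁻¹-pos = ℚ.1/pos⇒pos B
      δ : ℚ
      δ = (ℚ.1/ B) * ε
      instance
        δ-pos : Positive δ
        δ-pos = ℚ.pos*pos⇒pos (ℚ.1/ B) ε
      eq : B * δ ≡ ε
      eq = ≡.trans (≡.sym (ℚ.*-assoc B (ℚ.1/ B) ε))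
             (≡.trans (≡.cong (_* ε) (ℚ.*-inverseʳ B)) (ℚ.*-identityˡ ε))

    product-small : ∀ {p q B δ ε} → 0ℚ < B → B * δ ≡ ε →
                    ∣ p ∣ < B → ∣ q ∣ < δ → ∣ p * q ∣ < ε
    product-small {p} {q} {B} {δ} {ε} 0<B Bδ≡ε p<B q<δ =
      ≡.subst₂ _<_ (≡.sym (ℚ.∣p*q∣≡∣p∣*∣q∣ p q)) Bδ≡ε
        (ℚ.≤-<-trans
          (ℚ.*-monoʳ-≤-nonNeg ∣ q ∣ {{ℚ.∣-∣-nonNeg q}} (ℚ.<⇒≤ p<B))
          (ℚ.*-monoʳ-<-pos B {{positive 0<B}} q<δ))

open ℚ-estimates

-- The real numbers are Cauchy sequences of rationals modulo null sequences (_≈_).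
IsCauchy : (ℕ → ℚ) → Set
IsCauchy s = ∀ ε → 0ℚ ℚ.< ε →
  ∃ λ N → ∀ m n → N ℕ.≤ m → N ℕ.≤ n → ℚ.∣ s m ℚ.- s n ∣ ℚ.< ε

record ℝ : Set where
  no-eta-equality
  constructor mkℝ
  field
    seq    : ℕ → ℚ
    cauchy : IsCauchy seq

open ℝ public

infix 4 _≈_ _<_

record _≈_ (x y : ℝ) : Set where
  constructor mk≈
  field
    null : ∀ ε → 0ℚ ℚ.< ε →
      ∃ λ N → ∀ n → N ℕ.≤ n → ℚ.∣ seq x n ℚ.- seq y n ∣ ℚ.< ε

open _≈_ public

record _<_ (x y : ℝ) : Set where
  constructor mk<
  field
    gap        : ℚ
    gap-pos    : 0ℚ ℚ.< gap
    from       : ℕ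
    eventually : ∀ n → from ℕ.≤ n → seq x n ℚ.+ gap ℚ.< seq y n

fromℚ : ℚ → ℝ
fromℚ q = mkℝ (λ _ → q) λ ε 0<ε →
  0 , λ _ _ _ _ → ≡.subst (ℚ._< ε) (≡.sym (≡.cong ℚ.∣_∣ (ℚ.+-inverseʳ q))) 0<ε

fromℤ : ℤ → ℝ
fromℤ k = fromℚ (k ℚ./ 1)

0ℝ 1ℝ : ℝ
0ℝ = fromℚ 0ℚ
1ℝ = fromℚ 1ℚ

infixl 6 _+_ _-_
infixl 7 _*_
infix  8 -_

private
  ⊔ˡ : ∀ M N {n} → M ℕ.⊔ N ℕ.≤ n → M ℕ.≤ n
  ⊔ˡ M N = ℕ.≤-trans (ℕ.m≤m⊔n M N)

  ⊔ʳ : ∀ M N {n} → M ℕ.⊔ N ℕ.≤ n → N ℕ.≤ n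
  ⊔ʳ M N = ℕ.≤-trans (ℕ.m≤n⊔m M N)

  ⊔₄ : ∀ K L M N {n} → (K ℕ.⊔ L) ℕ.⊔ (M ℕ.⊔ N) ℕ.≤ n →
       K ℕ.≤ n × L ℕ.≤ n × M ℕ.≤ n × N ℕ.≤ n
  ⊔₄ K L M N n≥ = ⊔ˡ K L kl , ⊔ʳ K L kl , ⊔ˡ M N mn , ⊔ʳ M N mn
    where
    kl = ⊔ˡ (K ℕ.⊔ L) (M ℕ.⊔ N) n≥
    mn = ⊔ʳ (K ℕ.⊔ L) (M ℕ.⊔ N) n≥

  +-rearrange : ∀ a b c d → (a ℚ.- b) ℚ.+ (c ℚ.- d) ≡ (a ℚ.+ c) ℚ.- (b ℚ.+ d)
  +-rearrange = solve 4 (λ a b c d → (a :- b) :+ (c :- d) := (a :+ c) :- (b :+ d)) ≡.refl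
    where open +-*-Solver

  *-rearrange : ∀ a b c d → a ℚ.* (c ℚ.- d) ℚ.+ d ℚ.* (a ℚ.- b) ≡ a ℚ.* c ℚ.- b ℚ.* d
  *-rearrange = solve 4 (λ a b c d → a :* (c :- d) :+ d :* (a :- b) := a :* c :- b :* d) ≡.refl
    where open +-*-Solver

  neg-rearrange : ∀ a b → ℚ.- (a ℚ.- b) ≡ (ℚ.- a) ℚ.- (ℚ.- b)
  neg-rearrange = solve 2 (λ a b → :- (a :- b) := (:- a) :- (:- b)) ≡.refl
    where open +-*-Solver

  minus-plus : ∀ a b → (a ℚ.- b) ℚ.+ b ≡ a
  minus-plus = solve 2 (λ a b → (a :- b) :+ b := a) ≡.refl
    where open +-*-Solver

  swap-minus : ∀ a b → ℚ.- (a ℚ.- b) ≡ b ℚ.- a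
  swap-minus = solve 2 (λ a b → :- (a :- b) := b :- a) ≡.refl
    where open +-*-Solver

  telescope : ∀ a b c → (a ℚ.- b) ℚ.+ (b ℚ.- c) ≡ a ℚ.- c
  telescope = solve 3 (λ a b c → (a :- b) :+ (b :- c) := a :- c) ≡.refl
    where open +-*-Solver

  small-cong : ∀ {p q ε} → p ≡ q → ℚ.∣ p ∣ ℚ.< ε → ℚ.∣ q ∣ ℚ.< ε
  small-cong ≡.refl p< = p<

  neg-small : ∀ {p ε} → ℚ.∣ p ∣ ℚ.< ε → ℚ.∣ ℚ.- p ∣ ℚ.< ε
  neg-small {p} {ε} = ≡.subst (ℚ._< ε) (≡.sym (ℚ.∣-p∣≡∣p∣ p))

  bounded : ∀ x → Σ ℚ λ B → 0ℚ ℚ.< B × ∃ λ N → ∀ n → N ℕ.≤ n → ℚ.∣ seq x n ∣ ℚ.< B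
  bounded x with cauchy x 1ℚ (ℚ.positive⁻¹ 1ℚ)
  ... | N , close = B , 0<B , N , λ n N≤n →
        ℚ.≤-<-trans
          (≡.subst (λ t → ℚ.∣ t ∣ ℚ.≤ ℚ.∣ seq x n ℚ.- seq x N ∣ ℚ.+ ℚ.∣ seq x N ∣)
            (minus-plus (seq x n) (seq x N))
            (ℚ.∣p+q∣≤∣p∣+∣q∣ (seq x n ℚ.- seq x N) (seq x N)))
          (ℚ.+-mono-<-≤ (close n N N≤n ℕ.≤-refl) ℚ.≤-refl)
    where
    B : ℚ
    B = 1ℚ ℚ.+ ℚ.∣ seq x N ∣
    0<B : 0ℚ ℚ.< B
    0<B = ℚ.+-mono-<-≤ (ℚ.positive⁻¹ 1ℚ) (ℚ.0≤∣p∣ (seq x N))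

private
  +-cauchy : ∀ x y → IsCauchy (λ n → seq x n ℚ.+ seq y n)
  +-cauchy x y ε 0<ε =
    let M , xs = cauchy x (½ ℚ.* ε) (half-pos 0<ε)
        N , ys = cauchy y (½ ℚ.* ε) (half-pos 0<ε)
    in M ℕ.⊔ N , λ m n m≥ n≥ →
       small-cong (+-rearrange (seq x m) (seq x n) (seq y m) (seq y n))
         (sum-small {seq x m ℚ.- seq x n} {seq y m ℚ.- seq y n} {ε}
           (xs m n (⊔ˡ M N m≥) (⊔ˡ M N n≥)) (ys m n (⊔ʳ M N m≥) (⊔ʳ M N n≥)))

  neg-cauchy : ∀ x → IsCauchy (λ n → ℚ.- seq x n)
  neg-cauchy x ε 0<ε =
    let N , xs = cauchy x ε 0<ε
    in N , λ m n m≥ n≥ →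
       small-cong (neg-rearrange (seq x m) (seq x n))
         (neg-small {seq x m ℚ.- seq x n} (xs m n m≥ n≥))

  *-cauchy : ∀ x y → IsCauchy (λ n → seq x n ℚ.* seq y n)
  *-cauchy x y ε 0<ε =
    let B , 0<B , K , xB = bounded x
        C , 0<C , L , yC = bounded y
        δ , 0<δ , Bδ = shrink 0<B (half-pos 0<ε)
        η , 0<η , Cη = shrink 0<C (half-pos 0<ε)
        M , ys = cauchy y δ 0<δ
        N , xs = cauchy x η 0<η
    in (K ℕ.⊔ L) ℕ.⊔ (M ℕ.⊔ N) , λ m n m≥ n≥ →
       let K≤m , _ , M≤m , N≤m = ⊔₄ K L M N m≥
           _ , L≤n , M≤n , N≤n = ⊔₄ K L M N n≥
       in small-cong (*-rearrange (seq x m) (seq x n) (seq y m) (seq y n))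
         (sum-small {seq x m ℚ.* (seq y m ℚ.- seq y n)} {seq y n ℚ.* (seq x m ℚ.- seq x n)} {ε}
           (product-small {seq x m} {seq y m ℚ.- seq y n} 0<B Bδ (xB m K≤m) (ys m n M≤m M≤n))
           (product-small {seq y n} {seq x m ℚ.- seq x n} 0<C Cη (yC n L≤n) (xs m n N≤m N≤n)))

-- Opaque so that unification treats the operations as rigid.
opaque
  _+_ : ℝ → ℝ → ℝ
  x + y = mkℝ (λ n → seq x n ℚ.+ seq y n) (+-cauchy x y)

  -_ : ℝ → ℝ
  - x = mkℝ (λ n → ℚ.- seq x n) (neg-cauchy x)

  _*_ : ℝ → ℝ → ℝ
  x * y = mkℝ (λ n → seq x n ℚ.* seq y n) (*-cauchy x y)

_-_ : ℝ → ℝ → ℝ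
x - y = x + (- y)

opaque
  unfolding _+_ -_ _*_

  seq-+ : ∀ x y n → seq (x + y) n ≡ seq x n ℚ.+ seq y n
  seq-+ x y n = ≡.refl

  seq-neg : ∀ x n → seq (- x) n ≡ ℚ.- seq x n
  seq-neg x n = ≡.refl

  seq-* : ∀ x y n → seq (x * y) n ≡ seq x n ℚ.* seq y n
  seq-* x y n = ≡.refl

private
  pointwise : ∀ {x y} → (∀ n → seq x n ≡ seq y n) → x ≈ y
  pointwise {x} {y} eq = mk≈ λ ε 0<ε → 0 , λ n _ →
    ≡.subst (λ t → ℚ.∣ t ∣ ℚ.< ε)
      (≡.trans (≡.sym (ℚ.+-inverseʳ (seq x n))) (≡.cong (λ t → seq x n ℚ.- t) (eq n)))
      0<ε

  ≈-refl : ∀ {x} → x ≈ x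
  ≈-refl = pointwise λ _ → ≡.refl

  ≈-sym : ∀ {x y} → x ≈ y → y ≈ x
  ≈-sym {x} {y} x≈y = mk≈ λ ε 0<ε →
    let N , xy = null x≈y ε 0<ε
    in N , λ n n≥ → small-cong (swap-minus (seq x n) (seq y n))
                      (neg-small {seq x n ℚ.- seq y n} (xy n n≥))

  ≈-trans : ∀ {x y z} → x ≈ y → y ≈ z → x ≈ z
  ≈-trans {x} {y} {z} x≈y y≈z = mk≈ λ ε 0<ε →
    let M , xy = null x≈y (½ ℚ.* ε) (half-pos 0<ε)
        N , yz = null y≈z (½ ℚ.* ε) (half-pos 0<ε)
    in M ℕ.⊔ N , λ n n≥ →
       small-cong (telescope (seq x n) (seq y n) (seq z n))
         (sum-small {seq x n ℚ.- seq y n} {seq y n ℚ.- seq z n} {ε}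
           (xy n (⊔ˡ M N n≥)) (yz n (⊔ʳ M N n≥)))

private opaque
  unfolding _+_ -_ _*_

  +-cong : ∀ {x y u v} → x ≈ y → u ≈ v → x + u ≈ y + v
  +-cong {x} {y} {u} {v} x≈y u≈v = mk≈ λ ε 0<ε →
    let M , xy = null x≈y (½ ℚ.* ε) (half-pos 0<ε)
        N , uv = null u≈v (½ ℚ.* ε) (half-pos 0<ε)
    in M ℕ.⊔ N , λ n n≥ →
       small-cong (+-rearrange (seq x n) (seq y n) (seq u n) (seq v n))
         (sum-small {seq x n ℚ.- seq y n} {seq u n ℚ.- seq v n} {ε}
           (xy n (⊔ˡ M N n≥)) (uv n (⊔ʳ M N n≥)))

  -‿cong : ∀ {x y} → x ≈ y → - x ≈ - y
  -‿cong {x} {y} x≈y = mk≈ λ ε 0<ε →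
    let N , xy = null x≈y ε 0<ε
    in N , λ n n≥ → small-cong (neg-rearrange (seq x n) (seq y n))
                      (neg-small {seq x n ℚ.- seq y n} (xy n n≥))

  *-cong : ∀ {x y u v} → x ≈ y → u ≈ v → x * u ≈ y * v
  *-cong {x} {y} {u} {v} x≈y u≈v = mk≈ λ ε 0<ε →
    let B , 0<B , K , xB = bounded x
        C , 0<C , L , vC = bounded v
        δ , 0<δ , Bδ = shrink 0<B (half-pos 0<ε)
        η , 0<η , Cη = shrink 0<C (half-pos 0<ε)
        M , uv = null u≈v δ 0<δ
        N , xy = null x≈y η 0<η
    in (K ℕ.⊔ L) ℕ.⊔ (M ℕ.⊔ N) , λ n n≥ →
       let K≤n , L≤n , M≤n , N≤n = ⊔₄ K L M N n≥
       in small-cong (*-rearrange (seq x n) (seq y n) (seq u n) (seq v n))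
         (sum-small {seq x n ℚ.* (seq u n ℚ.- seq v n)} {seq v n ℚ.* (seq x n ℚ.- seq y n)} {ε}
           (product-small {seq x n} {seq u n ℚ.- seq v n} 0<B Bδ (xB n K≤n) (uv n M≤n))
           (product-small {seq v n} {seq x n ℚ.- seq y n} 0<C Cη (vC n L≤n) (xy n N≤n)))

  +-assoc : ∀ x y z → (x + y) + z ≈ x + (y + z)
  +-assoc x y z = pointwise λ n → ℚ.+-assoc (seq x n) (seq y n) (seq z n)

  +-identityˡ : ∀ x → 0ℝ + x ≈ x
  +-identityˡ x = pointwise λ n → ℚ.+-identityˡ (seq x n)

  +-inverseˡ : ∀ x → (- x) + x ≈ 0ℝ
  +-inverseˡ x = pointwise λ n → ℚ.+-inverseˡ (seq x n)

  +-comm : ∀ x y → x + y ≈ y + x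
  +-comm x y = pointwise λ n → ℚ.+-comm (seq x n) (seq y n)

  *-assoc : ∀ x y z → (x * y) * z ≈ x * (y * z)
  *-assoc x y z = pointwise λ n → ℚ.*-assoc (seq x n) (seq y n) (seq z n)

  *-identityˡ : ∀ x → 1ℝ * x ≈ x
  *-identityˡ x = pointwise λ n → ℚ.*-identityˡ (seq x n)

  *-distribˡ-+ : ∀ x y z → x * (y + z) ≈ x * y + x * z
  *-distribˡ-+ x y z = pointwise λ n → ℚ.*-distribˡ-+ (seq x n) (seq y n) (seq z n)

  *-comm : ∀ x y → x * y ≈ y * x
  *-comm x y = pointwise λ n → ℚ.*-comm (seq x n) (seq y n)

  fromℚ-+ : ∀ p q → fromℚ (p ℚ.+ q) ≈ fromℚ p + fromℚ q
  fromℚ-+ p q = pointwise λ _ → ≡.refl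

  fromℚ-* : ∀ p q → fromℚ (p ℚ.* q) ≈ fromℚ p * fromℚ q
  fromℚ-* p q = pointwise λ _ → ≡.refl

  fromℚ-neg : ∀ p → fromℚ (ℚ.- p) ≈ - fromℚ p
  fromℚ-neg p = pointwise λ _ → ≡.refl

ℝ-setoid : Setoid 0ℓ 0ℓ
ℝ-setoid = record
  { Carrier = ℝ
  ; _≈_ = _≈_
  ; isEquivalence = record { refl = ≈-refl ; sym = ≈-sym ; trans = ≈-trans }
  }

ℝ-commutativeRing : CommutativeRing 0ℓ 0ℓ
ℝ-commutativeRing = record
  { Carrier = ℝ
  ; _≈_ = _≈_
  ; _+_ = _+_
  ; _*_ = _*_
  ; -_ = -_
  ; 0# = 0ℝ
  ; 1# = 1ℝ
  ; isCommutativeRing = record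
    { isRing = record
      { +-isAbelianGroup = record
        { isGroup = record
          { isMonoid = record
            { isSemigroup = record
              { isMagma = record
                { isEquivalence = Setoid.isEquivalence ℝ-setoid
                ; ∙-cong = +-cong
                }
              ; assoc = +-assoc
              }
            ; identity = comm∧idˡ⇒id +-comm +-identityˡ
            }
          ; inverse = comm∧invˡ⇒inv +-comm +-inverseˡ
          ; ⁻¹-cong = -‿cong
          }
        ; comm = +-comm
        }
      ; *-cong = *-cong
      ; *-assoc = *-assoc
      ; *-identity = comm∧idˡ⇒id *-comm *-identityˡ
      ; distrib = comm∧distrˡ⇒distr +-cong *-comm *-distribˡ-+
      }
    ; *-comm = *-comm
    }
  }
  where
  open import Algebra.Consequences.Setoid ℝ-setoid

private
  module R = CommutativeRing ℝ-commutativeRing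
  open SemiringSum R.semiring using (sum; sum-cong-≋; ∑-distrib-+; *-distribˡ-sum)

  fromℚ-morphism : ℚ.+-*-rawRing -Raw-AlmostCommutative⟶ fromCommutativeRing ℝ-commutativeRing
  fromℚ-morphism = record
    { ⟦_⟧ = fromℚ
    ; +-homo = fromℚ-+
    ; *-homo = fromℚ-*
    ; -‿homo = fromℚ-neg
    ; 0-homo = ≈-refl
    ; 1-homo = ≈-refl
    }

  fromℚ-≟ : ∀ p q → Maybe.Maybe (fromℚ p ≈ fromℚ q)
  fromℚ-≟ p q = Maybe.map (R.reflexive ∘ ≡.cong fromℚ) (dec⇒maybe (p ℚ.≟ q))

module ℝ-Solver =
  RingSolver ℚ.+-*-rawRing (fromCommutativeRing ℝ-commutativeRing) fromℚ-morphism fromℚ-≟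

private
  fromℤ-+ : ∀ k l → fromℤ (k ℤ.+ l) ≈ fromℤ k + fromℤ l
  fromℤ-+ k l = R.trans (R.reflexive (≡.cong fromℚ (ℚ.toℚᵘ-injective (begin
    ℚ.toℚᵘ ((k ℤ.+ l) ℚ./ 1)                      ≈⟨ toFrom (k ℤ.+ l) ⟩
    (k ℤ.+ l) ℚᵘ./ 1                              ≈⟨ ℚᵘ.*≡* (≡.cong (ℤ._* ℤ.1ℤ) eq) ⟩
    (k ℚᵘ./ 1) ℚᵘ.+ (l ℚᵘ./ 1)                    ≈⟨ ℚᵘₚ.+-cong (toFrom k) (toFrom l) ⟨
    ℚ.toℚᵘ (k ℚ./ 1) ℚᵘ.+ ℚ.toℚᵘ (l ℚ./ 1)        ≈⟨ ℚ.toℚᵘ-homo-+ (k ℚ./ 1) (l ℚ./ 1) ⟨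
    ℚ.toℚᵘ (k ℚ./ 1 ℚ.+ l ℚ./ 1)                  ∎)))) (fromℚ-+ (k ℚ./ 1) (l ℚ./ 1))
    where
    import Data.Rational.Unnormalised.Properties as ℚᵘₚ
    open SetoidReasoning ℚᵘₚ.≃-setoid
    toFrom : ∀ m → ℚ.toℚᵘ (m ℚ./ 1) ℚᵘ.≃ (m ℚᵘ./ 1)
    toFrom m = ℚ.toℚᵘ-fromℚᵘ (m ℚᵘ./ 1)
    eq : k ℤ.+ l ≡ k ℤ.* ℤ.1ℤ ℤ.+ l ℤ.* ℤ.1ℤ
    eq = ≡.sym (≡.cong₂ ℤ._+_ (ℤ.*-identityʳ k) (ℤ.*-identityʳ l))

combination : ∀ {n} → (Fin n → ℝ) → (Fin n → Vector ℝ n) → Vector ℝ n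
combination c b j = sum (λ i → c i * b i j)

-- n linearly independent vectors of ℝⁿ form a basis, so this is the ℤ-span
-- of an ℝ-basis.
record IsLattice {n} (L : Pred (Vector ℝ n) 0ℓ) : Set where
  field
    basis       : Fin n → Vector ℝ n
    independent : ∀ c → (∀ j → combination c basis j ≈ 0ℝ) → ∀ i → c i ≈ 0ℝ
    spanned     : ∀ x → x ∈ L ⇔
                  ∃ λ (k : Fin n → ℤ) → ∀ j → x j ≈ combination (fromℤ ∘ k) basis j

record Lattice (n : ℕ) : Set₁ where
  field
    points    : Pred (Vector ℝ n) 0ℓ
    isLattice : IsLattice points

  open IsLattice isLattice public

private
  module LatticeClosure {n} (L : Lattice n) where
    open Lattice L

    to : ∀ {x} → x ∈ points → ∃ λ (k : Fin n → ℤ) → ∀ j → x j ≈ combination (fromℤ ∘ k) basis j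
    to = Equivalence.to (spanned _)

    from-≈ : ∀ {x} (k : Fin n → ℤ) → (∀ j → x j ≈ combination (fromℤ ∘ k) basis j) → x ∈ points
    from-≈ k x≈ = Equivalence.from (spanned _) (k , x≈)

    combination-+ : ∀ (k l : Fin n → ℤ) j →
      combination (fromℤ ∘ λ i → k i ℤ.+ l i) basis j
        ≈ combination (fromℤ ∘ k) basis j + combination (fromℤ ∘ l) basis j
    combination-+ k l j = R.trans
      (sum-cong-≋ λ i → R.trans (R.*-congʳ (fromℤ-+ (k i) (l i))) (R.distribʳ _ _ _))
      (∑-distrib-+ (λ i → fromℤ (k i) * basis i j) (λ i → fromℤ (l i) * basis i j))

    combination-0 : ∀ j → combination (fromℤ ∘ λ _ → ℤ.0ℤ) basis j ≈ 0ℝ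
    combination-0 j = R.trans (R.sym (*-distribˡ-sum 0ℝ (λ i → basis i j))) (R.zeroˡ _)

    combination-neg : ∀ (k : Fin n → ℤ) j →
      - combination (fromℤ ∘ k) basis j ≈ combination (fromℤ ∘ λ i → ℤ.- k i) basis j
    combination-neg k j = R.sym (GroupProperties.inverseʳ-unique R.+-group _ _
      (R.trans (R.sym (combination-+ k (λ i → ℤ.- k i) j))
        (R.trans (sum-cong-≋ λ i → R.*-congʳ (R.reflexive (≡.cong fromℤ (ℤ.+-inverseʳ (k i)))))
          (combination-0 j))))

    0∈ : (λ _ → 0ℝ) ∈ points
    0∈ = from-≈ (λ _ → ℤ.0ℤ) (λ j → R.sym (combination-0 j))

    +∈ : ∀ {x y} → x ∈ points → y ∈ points → (λ j → x j + y j) ∈ points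
    +∈ x∈ y∈ with to x∈ | to y∈
    ... | k , x≈ | l , y≈ = from-≈ (λ i → k i ℤ.+ l i) λ j →
      R.trans (R.+-cong (x≈ j) (y≈ j)) (R.sym (combination-+ k l j))

    neg∈ : ∀ {x} → x ∈ points → (λ j → - x j) ∈ points
    neg∈ x∈ with to x∈
    ... | k , x≈ = from-≈ (λ i → ℤ.- k i) λ j →
      R.trans (R.-‿cong (x≈ j)) (combination-neg k j)

record SL₂ : Set where
  no-eta-equality
  constructor mkSL₂
  field
    a b c d : ℝ
    det≈1   : a * d - b * c ≈ 1ℝ

open SL₂ public

record _≈ₛ_ (A B : SL₂) : Set where
  constructor mk≈ₛ
  field
    a≈ : a A ≈ a B
    b≈ : b A ≈ b B
    c≈ : c A ≈ c B
    d≈ : d A ≈ d B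

infixl 7 _*ₛ_

private abstract
  open ℝ-Solver

  det-1ₛ : 1ℝ * 1ℝ - 0ℝ * 0ℝ ≈ 1ℝ
  det-1ₛ = solve 0 (con 1ℚ :* con 1ℚ :- con 0ℚ :* con 0ℚ := con 1ℚ) R.refl

  det-*ₛ : ∀ A B → (a A * a B + b A * c B) * (c A * b B + d A * d B)
                     - (a A * b B + b A * d B) * (c A * a B + d A * c B) ≈ 1ℝ
  det-*ₛ A B = R.trans
    (solve 8 (λ a b c d e f g h →
      (a :* e :+ b :* g) :* (c :* f :+ d :* h) :- (a :* f :+ b :* h) :* (c :* e :+ d :* g)
        := (a :* d :- b :* c) :* (e :* h :- f :* g)) R.refl
      (a A) (b A) (c A) (d A) (a B) (b B) (c B) (d B))
    (R.trans (R.*-cong (det≈1 A) (det≈1 B)) (R.*-identityˡ 1ℝ))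

  det-⁻¹ₛ : ∀ A → d A * a A - (- b A) * (- c A) ≈ 1ℝ
  det-⁻¹ₛ A = R.trans
    (solve 4 (λ a b c d → d :* a :- (:- b) :* (:- c) := a :* d :- b :* c) R.refl
      (a A) (b A) (c A) (d A))
    (det≈1 A)

  det--ₛ : ∀ A → (- a A) * (- d A) - (- b A) * (- c A) ≈ 1ℝ
  det--ₛ A = R.trans
    (solve 4 (λ a b c d → (:- a) :* (:- d) :- (:- b) :* (:- c) := a :* d :- b :* c) R.refl
      (a A) (b A) (c A) (d A))
    (det≈1 A)

  det-T : ∀ x → 1ℝ * 1ℝ - x * 0ℝ ≈ 1ℝ
  det-T = solve 1 (λ x → con 1ℚ :* con 1ℚ :- x :* con 0ℚ := con 1ℚ) R.refl

  det-V : ∀ x → 1ℝ * 1ℝ - 0ℝ * x ≈ 1ℝ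
  det-V = solve 1 (λ x → con 1ℚ :* con 1ℚ :- con 0ℚ :* x := con 1ℚ) R.refl

1ₛ : SL₂
1ₛ = mkSL₂ 1ℝ 0ℝ 0ℝ 1ℝ det-1ₛ

_*ₛ_ : SL₂ → SL₂ → SL₂
A *ₛ B = mkSL₂
  (a A * a B + b A * c B) (a A * b B + b A * d B)
  (c A * a B + d A * c B) (c A * b B + d A * d B)
  (det-*ₛ A B)

_⁻¹ₛ : SL₂ → SL₂
A ⁻¹ₛ = mkSL₂ (d A) (- b A) (- c A) (a A) (det-⁻¹ₛ A)

-ₛ_ : SL₂ → SL₂
-ₛ A = mkSL₂ (- a A) (- b A) (- c A) (- d A) (det--ₛ A)

infix 4 _≈ₛ_ _≈ₚ_

-- Elements of PSL₂(ℝ) = SL₂(ℝ)/{±1} are represented by matrices in SL₂(ℝ), and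
-- _≈ₚ_ is equality in the quotient.
_≈ₚ_ : SL₂ → SL₂ → Set
A ≈ₚ B = (A ≈ₛ B) ⊎ (A ≈ₛ -ₛ B)

private
  ≈ₛ-refl : ∀ {A} → A ≈ₛ A
  ≈ₛ-refl = mk≈ₛ R.refl R.refl R.refl R.refl

  ≈ₛ-sym : ∀ {A B} → A ≈ₛ B → B ≈ₛ A
  ≈ₛ-sym (mk≈ₛ p q r s) = mk≈ₛ (R.sym p) (R.sym q) (R.sym r) (R.sym s)

  ≈ₛ-trans : ∀ {A B C} → A ≈ₛ B → B ≈ₛ C → A ≈ₛ C
  ≈ₛ-trans (mk≈ₛ p q r s) (mk≈ₛ p₂ q₂ r₂ s₂) =
    mk≈ₛ (R.trans p p₂) (R.trans q q₂) (R.trans r r₂) (R.trans s s₂)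

  -ₛ-cong : ∀ {A B} → A ≈ₛ B → -ₛ A ≈ₛ -ₛ B
  -ₛ-cong (mk≈ₛ p q r s) = mk≈ₛ (R.-‿cong p) (R.-‿cong q) (R.-‿cong r) (R.-‿cong s)

  -ₛ-involutive : ∀ A → -ₛ (-ₛ A) ≈ₛ A
  -ₛ-involutive A = mk≈ₛ (nn (a A)) (nn (b A)) (nn (c A)) (nn (d A))
    where
    open ℝ-Solver
    nn : ∀ x → - (- x) ≈ x
    nn = solve 1 (λ x → :- (:- x) := x) R.refl

  *ₛ-cong : ∀ {A B C D} → A ≈ₛ B → C ≈ₛ D → A *ₛ C ≈ₛ B *ₛ D
  *ₛ-cong (mk≈ₛ p q r s) (mk≈ₛ t u v w) = mk≈ₛ
    (R.+-cong (R.*-cong p t) (R.*-cong q v)) (R.+-cong (R.*-cong p u) (R.*-cong q w))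
    (R.+-cong (R.*-cong r t) (R.*-cong s v)) (R.+-cong (R.*-cong r u) (R.*-cong s w))

  ⁻¹ₛ-cong : ∀ {A B} → A ≈ₛ B → A ⁻¹ₛ ≈ₛ B ⁻¹ₛ
  ⁻¹ₛ-cong (mk≈ₛ p q r s) = mk≈ₛ s (R.-‿cong q) (R.-‿cong r) p

  neg-*ₛ : ∀ A B → (-ₛ A) *ₛ B ≈ₛ -ₛ (A *ₛ B)
  neg-*ₛ A B = mk≈ₛ (nl (a A) (b A) (a B) (c B)) (nl (a A) (b A) (b B) (d B))
                    (nl (c A) (d A) (a B) (c B)) (nl (c A) (d A) (b B) (d B))
    where
    open ℝ-Solver
    nl : ∀ x y p q → (- x) * p + (- y) * q ≈ - (x * p + y * q)
    nl = solve 4 (λ x y p q → (:- x) :* p :+ (:- y) :* q := :- (x :* p :+ y :* q)) R.refl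

  *ₛ-neg : ∀ A B → A *ₛ (-ₛ B) ≈ₛ -ₛ (A *ₛ B)
  *ₛ-neg A B = mk≈ₛ (nr (a A) (b A) (a B) (c B)) (nr (a A) (b A) (b B) (d B))
                    (nr (c A) (d A) (a B) (c B)) (nr (c A) (d A) (b B) (d B))
    where
    open ℝ-Solver
    nr : ∀ x y p q → x * (- p) + y * (- q) ≈ - (x * p + y * q)
    nr = solve 4 (λ x y p q → x :* (:- p) :+ y :* (:- q) := :- (x :* p :+ y :* q)) R.refl

  *ₛ-assoc : ∀ A B C → (A *ₛ B) *ₛ C ≈ₛ A *ₛ (B *ₛ C)
  *ₛ-assoc A B C = mk≈ₛ (row (a A) (b A) (a C) (c C)) (row (a A) (b A) (b C) (d C))
                        (row (c A) (d A) (a C) (c C)) (row (c A) (d A) (b C) (d C))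
    where
    open ℝ-Solver
    row : ∀ x y p q → (x * a B + y * c B) * p + (x * b B + y * d B) * q
                        ≈ x * (a B * p + b B * q) + y * (c B * p + d B * q)
    row x y = solve 8 (λ x y e f g h p q →
      (x :* e :+ y :* g) :* p :+ (x :* f :+ y :* h) :* q
        := x :* (e :* p :+ f :* q) :+ y :* (g :* p :+ h :* q)) R.refl
      x y (a B) (b B) (c B) (d B)

  module Units where
    open ℝ-Solver
    10ˡ : ∀ p q → 1ℝ * p + 0ℝ * q ≈ p
    10ˡ = solve 2 (λ p q → con 1ℚ :* p :+ con 0ℚ :* q := p) R.refl
    01ˡ : ∀ p q → 0ℝ * p + 1ℝ * q ≈ q
    01ˡ = solve 2 (λ p q → con 0ℚ :* p :+ con 1ℚ :* q := q) R.refl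
    10ʳ : ∀ p q → p * 1ℝ + q * 0ℝ ≈ p
    10ʳ = solve 2 (λ p q → p :* con 1ℚ :+ q :* con 0ℚ := p) R.refl
    01ʳ : ∀ p q → p * 0ℝ + q * 1ℝ ≈ q
    01ʳ = solve 2 (λ p q → p :* con 0ℚ :+ q :* con 1ℚ := q) R.refl

  *ₛ-identityˡ : ∀ A → 1ₛ *ₛ A ≈ₛ A
  *ₛ-identityˡ A = mk≈ₛ (10ˡ (a A) (c A)) (10ˡ (b A) (d A)) (01ˡ (a A) (c A)) (01ˡ (b A) (d A))
    where open Units

  *ₛ-identityʳ : ∀ A → A *ₛ 1ₛ ≈ₛ A
  *ₛ-identityʳ A = mk≈ₛ (10ʳ (a A) (b A)) (01ʳ (a A) (b A)) (10ʳ (c A) (d A)) (01ʳ (c A) (d A))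
    where open Units

  *ₛ-inverseˡ : ∀ A → (A ⁻¹ₛ) *ₛ A ≈ₛ 1ₛ
  *ₛ-inverseˡ A = mk≈ₛ
    (R.trans (solve 4 (λ a b c d → d :* a :+ (:- b) :* c := a :* d :- b :* c) R.refl
               (a A) (b A) (c A) (d A)) (det≈1 A))
    (solve 2 (λ b d → d :* b :+ (:- b) :* d := con 0ℚ) R.refl (b A) (d A))
    (solve 2 (λ a c → (:- c) :* a :+ a :* c := con 0ℚ) R.refl (a A) (c A))
    (R.trans (solve 4 (λ a b c d → (:- c) :* b :+ a :* d := a :* d :- b :* c) R.refl
               (a A) (b A) (c A) (d A)) (det≈1 A))
    where open ℝ-Solver

  *ₛ-inverseʳ : ∀ A → A *ₛ (A ⁻¹ₛ) ≈ₛ 1ₛ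
  *ₛ-inverseʳ A = mk≈ₛ
    (R.trans (solve 4 (λ a b c d → a :* d :+ b :* (:- c) := a :* d :- b :* c) R.refl
               (a A) (b A) (c A) (d A)) (det≈1 A))
    (solve 2 (λ a b → a :* (:- b) :+ b :* a := con 0ℚ) R.refl (a A) (b A))
    (solve 2 (λ c d → c :* d :+ d :* (:- c) := con 0ℚ) R.refl (c A) (d A))
    (R.trans (solve 4 (λ a b c d → c :* (:- b) :+ d :* a := a :* d :- b :* c) R.refl
               (a A) (b A) (c A) (d A)) (det≈1 A))
    where open ℝ-Solver

  ≈ₚ-sym : ∀ {A B} → A ≈ₚ B → B ≈ₚ A
  ≈ₚ-sym (inj₁ p) = inj₁ (≈ₛ-sym p)
  ≈ₚ-sym {A} {B} (inj₂ p) = inj₂ (≈ₛ-sym (≈ₛ-trans (-ₛ-cong p) (-ₛ-involutive B)))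

  ≈ₚ-trans : ∀ {A B C} → A ≈ₚ B → B ≈ₚ C → A ≈ₚ C
  ≈ₚ-trans (inj₁ p) (inj₁ q) = inj₁ (≈ₛ-trans p q)
  ≈ₚ-trans (inj₁ p) (inj₂ q) = inj₂ (≈ₛ-trans p q)
  ≈ₚ-trans (inj₂ p) (inj₁ q) = inj₂ (≈ₛ-trans p (-ₛ-cong q))
  ≈ₚ-trans {C = C} (inj₂ p) (inj₂ q) =
    inj₁ (≈ₛ-trans p (≈ₛ-trans (-ₛ-cong q) (-ₛ-involutive C)))

  *ₚ-cong : ∀ {A B C D} → A ≈ₚ B → C ≈ₚ D → A *ₛ C ≈ₚ B *ₛ D
  *ₚ-cong (inj₁ p) (inj₁ q) = inj₁ (*ₛ-cong p q)
  *ₚ-cong {B = B} {D = D} (inj₁ p) (inj₂ q) = inj₂ (≈ₛ-trans (*ₛ-cong p q) (*ₛ-neg B D))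
  *ₚ-cong {B = B} {D = D} (inj₂ p) (inj₁ q) = inj₂ (≈ₛ-trans (*ₛ-cong p q) (neg-*ₛ B D))
  *ₚ-cong {B = B} {D = D} (inj₂ p) (inj₂ q) = inj₁
    (≈ₛ-trans (*ₛ-cong p q) (≈ₛ-trans (neg-*ₛ B (-ₛ D))
      (≈ₛ-trans (-ₛ-cong (*ₛ-neg B D)) (-ₛ-involutive (B *ₛ D)))))

  ⁻¹ₚ-cong : ∀ {A B} → A ≈ₚ B → A ⁻¹ₛ ≈ₚ B ⁻¹ₛ
  ⁻¹ₚ-cong (inj₁ p) = inj₁ (⁻¹ₛ-cong p)
  ⁻¹ₚ-cong (inj₂ (mk≈ₛ p q r s)) = inj₂ (mk≈ₛ s (R.-‿cong q) (R.-‿cong r) p)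

PSL₂ : Group 0ℓ 0ℓ
PSL₂ = record
  { Carrier = SL₂
  ; _≈_ = _≈ₚ_
  ; _∙_ = _*ₛ_
  ; ε = 1ₛ
  ; _⁻¹ = _⁻¹ₛ
  ; isGroup = record
    { isMonoid = record
      { isSemigroup = record
        { isMagma = record
          { isEquivalence = record { refl = inj₁ ≈ₛ-refl ; sym = ≈ₚ-sym ; trans = ≈ₚ-trans }
          ; ∙-cong = *ₚ-cong
          }
        ; assoc = λ A B C → inj₁ (*ₛ-assoc A B C)
        }
      ; identity = (λ A → inj₁ (*ₛ-identityˡ A)) , (λ A → inj₁ (*ₛ-identityʳ A))
      }
    ; inverse = (λ A → inj₁ (*ₛ-inverseˡ A)) , (λ A → inj₁ (*ₛ-inverseʳ A))
    ; ⁻¹-cong = ⁻¹ₚ-cong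
    }
  }

G : ℕ → Group 0ℓ 0ℓ
G n = Pointwise.group (Fin n) PSL₂

T V : ∀ {n} → Vector ℝ n → Group.Carrier (G n)
T x j = mkSL₂ 1ℝ (x j) 0ℝ 1ℝ (det-T (x j))
V x j = mkSL₂ 1ℝ 0ℝ (x j) 1ℝ (det-V (x j))

Within : ℝ → ℝ → ℝ → Set
Within ε x y = (- ε < x - y) × (x - y < ε)

record Close {n} (ε : ℝ) (g h : Fin n → SL₂) : Set where
  field
    a-close : ∀ j → Within ε (a (g j)) (a (h j))
    b-close : ∀ j → Within ε (b (g j)) (b (h j))
    c-close : ∀ j → Within ε (c (g j)) (c (h j))
    d-close : ∀ j → Within ε (d (g j)) (d (h j))

-- The quotient topology of SL₂(ℝ)ⁿ ⊆ ℝ⁴ⁿ: an open set of G is an open set of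
-- SL₂(ℝ)ⁿ that is saturated for the equality of G.  (The projection from
-- SL₂(ℝ)ⁿ is open, so this is also the product of the topologies of PSL₂(ℝ).)
record IsOpen {n} (U : Pred (Group.Carrier (G n)) 0ℓ) : Set where
  field
    saturated : U Respects (Group._≈_ (G n))
    ball      : ∀ g → g ∈ U → Σ ℝ λ ε → 0ℝ < ε × (∀ h → Close ε g h → h ∈ U)

IsDiscrete : ∀ {n} → Pred (Group.Carrier (G n)) 0ℓ → Set₁
IsDiscrete {n} S = ∀ g → g ∈ S →
  Σ (Pred (Group.Carrier (G n)) 0ℓ) λ U →
    IsOpen U × g ∈ U × (∀ h → h ∈ S → h ∈ U → Group._≈_ (G n) h g)

record Subgroup {c ℓ} (H : Group c ℓ) p : Set (c ⊔ ℓ ⊔ lsuc p) where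
  open Group H renaming (_≈_ to _≈ₕ_)
  field
    members : Pred Carrier p
    resp    : members Respects _≈ₕ_
    ε∈      : ε ∈ members
    ∙∈      : ∀ {x y} → x ∈ members → y ∈ members → x ∙ y ∈ members
    ⁻¹∈     : ∀ {x} → x ∈ members → x ⁻¹ ∈ members

  group : Group (c ⊔ p) ℓ
  group = record
    { Carrier = ∃ members
    ; _≈_ = λ x y → proj₁ x ≈ₕ proj₁ y
    ; _∙_ = λ x y → proj₁ x ∙ proj₁ y , ∙∈ (proj₂ x) (proj₂ y)
    ; ε = ε , ε∈
    ; _⁻¹ = λ x → proj₁ x ⁻¹ , ⁻¹∈ (proj₂ x)
    ; isGroup = record
      { isMonoid = record
        { isSemigroup = record
          { isMagma = record
            { isEquivalence = record { refl = refl ; sym = sym ; trans = trans }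
            ; ∙-cong = ∙-cong
            }
          ; assoc = λ x y z → assoc (proj₁ x) (proj₁ y) (proj₁ z)
          }
        ; identity = (λ x → identityˡ (proj₁ x)) , (λ x → identityʳ (proj₁ x))
        }
      ; inverse = (λ x → inverseˡ (proj₁ x)) , (λ x → inverseʳ (proj₁ x))
      ; ⁻¹-cong = ⁻¹-cong
      }
    }

module _ {c ℓ p} (H : Group c ℓ) (S : Pred (Group.Carrier H) p) where
  open Group H renaming (_≈_ to _≈ₕ_)

  data Generated : Pred Carrier (c ⊔ ℓ ⊔ p) where
    gen  : ∀ {x} → x ∈ S → x ∈ Generated
    resp : ∀ {x y} → x ≈ₕ y → x ∈ Generated → y ∈ Generated
    unit : ε ∈ Generated
    mul  : ∀ {x y} → x ∈ Generated → y ∈ Generated → x ∙ y ∈ Generated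
    inv  : ∀ {x} → x ∈ Generated → x ⁻¹ ∈ Generated

  ⟨_⟩ : Subgroup H (c ⊔ ℓ ⊔ p)
  ⟨_⟩ = record { members = Generated ; resp = resp ; ε∈ = unit ; ∙∈ = mul ; ⁻¹∈ = inv }

-- The free product of two groups: words in the letters of A ⊎ B, modulo the
-- congruence identifying each letter product within A or within B with its
-- value and each unit letter with the empty word.
module FreeProduct {c ℓ c′ ℓ′} (A : Group c ℓ) (B : Group c′ ℓ′) where
  private
    module A = Group A
    module B = Group B

  Word : Set (c ⊔ c′)
  Word = List (A.Carrier ⊎ B.Carrier)

  infix 4 _∼_

  data _∼_ : Rel Word (c ⊔ c′ ⊔ ℓ ⊔ ℓ′) where
    ∼-refl  : ∀ {u} → u ∼ u
    ∼-sym   : ∀ {u v} → u ∼ v → v ∼ u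
    ∼-trans : ∀ {u v w} → u ∼ v → v ∼ w → u ∼ w
    ++-cong : ∀ {u v s t} → u ∼ v → s ∼ t → u ++ s ∼ v ++ t
    ≈ˡ : ∀ {x y} → x A.≈ y → [ inj₁ x ] ∼ [ inj₁ y ]
    ∙ˡ : ∀ x y → inj₁ x ∷ inj₁ y ∷ [] ∼ [ inj₁ (x A.∙ y) ]
    εˡ : [ inj₁ A.ε ] ∼ []
    ≈ʳ : ∀ {x y} → x B.≈ y → [ inj₂ x ] ∼ [ inj₂ y ]
    ∙ʳ : ∀ x y → inj₂ x ∷ inj₂ y ∷ [] ∼ [ inj₂ (x B.∙ y) ]
    εʳ : [ inj₂ B.ε ] ∼ []

  inv-letter : A.Carrier ⊎ B.Carrier → A.Carrier ⊎ B.Carrier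
  inv-letter (inj₁ x) = inj₁ (x A.⁻¹)
  inv-letter (inj₂ y) = inj₂ (y B.⁻¹)

  inv-word : Word → Word
  inv-word []      = []
  inv-word (x ∷ w) = inv-word w ++ [ inv-letter x ]

  private
    ∼-reflexive : ∀ {u v} → u ≡ v → u ∼ v
    ∼-reflexive ≡.refl = ∼-refl

    letter-inverseˡ : ∀ x → inv-letter x ∷ x ∷ [] ∼ []
    letter-inverseˡ (inj₁ x) = ∼-trans (∙ˡ _ _) (∼-trans (≈ˡ (A.inverseˡ x)) εˡ)
    letter-inverseˡ (inj₂ y) = ∼-trans (∙ʳ _ _) (∼-trans (≈ʳ (B.inverseˡ y)) εʳ)

    letter-inverseʳ : ∀ x → x ∷ inv-letter x ∷ [] ∼ []
    letter-inverseʳ (inj₁ x) = ∼-trans (∙ˡ _ _) (∼-trans (≈ˡ (A.inverseʳ x)) εˡ)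
    letter-inverseʳ (inj₂ y) = ∼-trans (∙ʳ _ _) (∼-trans (≈ʳ (B.inverseʳ y)) εʳ)

    word-inverseˡ : ∀ w → inv-word w ++ w ∼ []
    word-inverseˡ []      = ∼-refl
    word-inverseˡ (x ∷ w) = ∼-trans
      (∼-reflexive (List.++-assoc (inv-word w) [ inv-letter x ] (x ∷ w)))
      (∼-trans (++-cong (∼-refl {inv-word w}) (++-cong (letter-inverseˡ x) (∼-refl {w})))
        (word-inverseˡ w))

    word-inverseʳ : ∀ w → w ++ inv-word w ∼ []
    word-inverseʳ []      = ∼-refl
    word-inverseʳ (x ∷ w) = ∼-trans
      (++-cong (∼-refl {[ x ]}) (∼-trans
        (∼-reflexive (≡.sym (List.++-assoc w (inv-word w) [ inv-letter x ])))
        (++-cong (word-inverseʳ w) (∼-refl {[ inv-letter x ]}))))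
      (letter-inverseʳ x)

    inv-word-cong : ∀ {u v} → u ∼ v → inv-word u ∼ inv-word v
    inv-word-cong {u} {v} u∼v =
      ∼-trans (∼-reflexive (≡.sym (List.++-identityʳ (inv-word u))))
      (∼-trans (++-cong (∼-refl {inv-word u}) (∼-sym (word-inverseʳ v)))
      (∼-trans (++-cong (∼-refl {inv-word u}) (++-cong (∼-sym u∼v) (∼-refl {inv-word v})))
      (∼-trans (∼-reflexive (≡.sym (List.++-assoc (inv-word u) u (inv-word v))))
      (++-cong (word-inverseˡ u) (∼-refl {inv-word v})))))

  group : Group (c ⊔ c′) (c ⊔ c′ ⊔ ℓ ⊔ ℓ′)
  group = record
    { Carrier = Word
    ; _≈_ = _∼_
    ; _∙_ = _++_
    ; ε = []
    ; _⁻¹ = inv-word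
    ; isGroup = record
      { isMonoid = record
        { isSemigroup = record
          { isMagma = record
            { isEquivalence = record { refl = ∼-refl ; sym = ∼-sym ; trans = ∼-trans }
            ; ∙-cong = ++-cong
            }
          ; assoc = λ u v w → ∼-reflexive (List.++-assoc u v w)
          }
        ; identity = (λ _ → ∼-refl) , (λ w → ∼-reflexive (List.++-identityʳ w))
        }
      ; inverse = word-inverseˡ , word-inverseʳ
      ; ⁻¹-cong = inv-word-cong
      }
    }

module Canonical {c ℓ p} {X : Group c ℓ} (H K : Subgroup X p) where
  open Subgroup

  join : Subgroup X (c ⊔ ℓ ⊔ p)
  join = ⟨_⟩ X (members H ∪ members K)

  open FreeProduct (group H) (group K) hiding (group)
  free : Group (c ⊔ p) (c ⊔ ℓ ⊔ p)
  free = FreeProduct.group (group H) (group K)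

  private
    module X = Group X
    module J = Group (group join)

  letter : Group.Carrier (group H) ⊎ Group.Carrier (group K) → J.Carrier
  letter (inj₁ (x , x∈)) = x , gen (inj₁ x∈)
  letter (inj₂ (x , x∈)) = x , gen (inj₂ x∈)

  canonical : Word → J.Carrier
  canonical = foldr (λ x g → letter x J.∙ g) J.ε

  private
    canonical-++ : ∀ u v → canonical (u ++ v) J.≈ canonical u J.∙ canonical v
    canonical-++ []      v = X.sym (X.identityˡ _)
    canonical-++ (x ∷ u) v = X.trans
      (X.∙-cong X.refl (canonical-++ u v))
      (X.sym (X.assoc _ _ _))

    canonical-cong : ∀ {u v} → u ∼ v → canonical u J.≈ canonical v
    canonical-cong ∼-refl        = X.refl
    canonical-cong (∼-sym p)     = X.sym (canonical-cong p)
    canonical-cong (∼-trans p q) = X.trans (canonical-cong p) (canonical-cong q)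
    canonical-cong (++-cong {u} {v} {s} {t} p q) = X.trans (canonical-++ u s)
      (X.trans (X.∙-cong (canonical-cong p) (canonical-cong q)) (X.sym (canonical-++ v t)))
    canonical-cong (≈ˡ p) = X.∙-cong p X.refl
    canonical-cong (∙ˡ x y) = X.sym (X.assoc _ _ _)
    canonical-cong εˡ = X.identityˡ _
    canonical-cong (≈ʳ p) = X.∙-cong p X.refl
    canonical-cong (∙ʳ x y) = X.sym (X.assoc _ _ _)
    canonical-cong εʳ = X.identityˡ _

  canonical-isGroupHomomorphism :
    IsGroupHomomorphism (Group.rawGroup free) (Group.rawGroup (group join)) canonical
  canonical-isGroupHomomorphism = record
    { isMonoidHomomorphism = record
      { isMagmaHomomorphism = record
        { isRelHomomorphism = record { cong = canonical-cong }
        ; homo = canonical-++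
        }
      ; ε-homo = X.refl
      }
    ; ⁻¹-homo = λ w → GroupProperties.inverseˡ-unique X _ _
        (X.trans (X.sym (canonical-++ (inv-word w) w)) (canonical-cong (Group.inverseˡ free w)))
    }

IsFreeInnerProduct : ∀ {c ℓ p} {X : Group c ℓ} → Subgroup X p → Subgroup X p → Set (c ⊔ ℓ ⊔ p)
IsFreeInnerProduct H K =
  IsGroupIsomorphism (Group.rawGroup free) (Group.rawGroup (Subgroup.group join)) canonical
  where open Canonical H K

private
  T-+ : ∀ {n} (x y : Vector ℝ n) j → T (λ i → x i + y i) j ≈ₛ T x j *ₛ T y j
  T-+ x y j = mk≈ₛ
    (solve 1 (λ x → con 1ℚ := con 1ℚ :* con 1ℚ :+ x :* con 0ℚ) R.refl (x j))
    (solve 2 (λ x y → x :+ y := con 1ℚ :* y :+ x :* con 1ℚ) R.refl (x j) (y j))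
    (solve 0 (con 0ℚ := con 0ℚ :* con 1ℚ :+ con 1ℚ :* con 0ℚ) R.refl)
    (solve 1 (λ y → con 1ℚ := con 0ℚ :* y :+ con 1ℚ :* con 1ℚ) R.refl (y j))
    where open ℝ-Solver

  V-+ : ∀ {n} (x y : Vector ℝ n) j → V (λ i → x i + y i) j ≈ₛ V x j *ₛ V y j
  V-+ x y j = mk≈ₛ
    (solve 1 (λ y → con 1ℚ := con 1ℚ :* con 1ℚ :+ con 0ℚ :* y) R.refl (y j))
    (solve 0 (con 0ℚ := con 1ℚ :* con 0ℚ :+ con 0ℚ :* con 1ℚ) R.refl)
    (solve 2 (λ x y → x :+ y := x :* con 1ℚ :+ con 1ℚ :* y) R.refl (x j) (y j))
    (solve 1 (λ x → con 1ℚ := x :* con 0ℚ :+ con 1ℚ :* con 1ℚ) R.refl (x j))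
    where open ℝ-Solver

  neg-zero : 0ℝ ≈ - 0ℝ
  neg-zero = solve 0 (con 0ℚ := :- con 0ℚ) R.refl
    where open ℝ-Solver

  T-neg : ∀ {n} (x : Vector ℝ n) j → T (λ i → - x i) j ≈ₛ (T x j) ⁻¹ₛ
  T-neg x j = mk≈ₛ R.refl R.refl neg-zero R.refl

  V-neg : ∀ {n} (x : Vector ℝ n) j → V (λ i → - x i) j ≈ₛ (V x j) ⁻¹ₛ
  V-neg x j = mk≈ₛ R.refl neg-zero R.refl R.refl

Γupp Γlow : ∀ {n} → Lattice n → Subgroup (G n) 0ℓ
Γupp {n} L = record
  { members = λ g → ∃ λ x → x ∈ Lattice.points L × g ≈G T x
  ; resp = λ { g≈h (x , x∈ , g≈) → x , x∈ , trans (sym g≈h) g≈ }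
  ; ε∈ = (λ _ → 0ℝ) , 0∈ , λ j → inj₁ (mk≈ₛ R.refl R.refl R.refl R.refl)
  ; ∙∈ = λ { (x , x∈ , g≈) (y , y∈ , h≈) → (λ j → x j + y j) , +∈ x∈ y∈ ,
             trans (∙-cong g≈ h≈) (λ j → inj₁ (≈ₛ-sym (T-+ x y j))) }
  ; ⁻¹∈ = λ { (x , x∈ , g≈) → (λ j → - x j) , neg∈ x∈ ,
              trans (⁻¹-cong g≈) (λ j → inj₁ (≈ₛ-sym (T-neg x j))) }
  }
  where
  open Group (G n) renaming (_≈_ to _≈G_)
  open LatticeClosure L
Γlow {n} L = record
  { members = λ g → ∃ λ y → y ∈ Lattice.points L × g ≈G V y
  ; resp = λ { g≈h (x , x∈ , g≈) → x , x∈ , trans (sym g≈h) g≈ }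
  ; ε∈ = (λ _ → 0ℝ) , 0∈ , λ j → inj₁ (mk≈ₛ R.refl R.refl R.refl R.refl)
  ; ∙∈ = λ { (x , x∈ , g≈) (y , y∈ , h≈) → (λ j → x j + y j) , +∈ x∈ y∈ ,
             trans (∙-cong g≈ h≈) (λ j → inj₁ (≈ₛ-sym (V-+ x y j))) }
  ; ⁻¹∈ = λ { (x , x∈ , g≈) → (λ j → - x j) , neg∈ x∈ ,
              trans (⁻¹-cong g≈) (λ j → inj₁ (≈ₛ-sym (V-neg x j))) }
  }
  where
  open Group (G n) renaming (_≈_ to _≈G_)
  open LatticeClosure L

Γ : ∀ {n} → Lattice n → Lattice n → Subgroup (G n) 0ℓ
Γ {n} L₁ L₂ = ⟨_⟩ (G n) (Subgroup.members (Γupp L₁) ∪ Subgroup.members (Γlow L₂))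

{-# OPTIONS --safe #-}
-- For x ∈ L₁, y ∈ L₂ and s = xy the commutator [V^y, T^x] has lower right entry 1 + s + s² ≥ 3/4.
-- Multiplying it by suitable T^u on the left and V^w on the right (u ∈ L₁, w ∈ L₂) keeps that
-- entry d and reduces b/d and c/d modulo the lattices, so all entries become bounded in terms of
-- s alone.  By Dirichlet's box principle there are, at each scale t, nonzero x and y with
-- |x| ≲ (t^(1-n), t, ..., t) and |y| ≲ (t^(n-1), 1/t, ..., 1/t), hence with s bounded
-- independently of t.  If n ≥ 2, such a pair occurs at arbitrarily large scales only if s = 0; then
-- T^x and V^y commute, which freeness forbids.  Thus there are infinitely many such pairs; by
-- discreteness two of the reduced commutators coincide, and in a free product this forces the
-- pairs to be equal.
module Submission where

open import Defs
open import Axiom.ExcludedMiddle using (ExcludedMiddle)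
open import Data.Nat.Base as ℕ using (ℕ; zero; suc; _≤_; s≤s; z≤n)
open import Level using (0ℓ; _⊔_)
open import Relation.Nullary.Negation using (¬_; contradiction)
open import Algebra.Bundles using (Group; AbelianGroup; CommutativeRing)
open import Algebra.Morphism.Structures using (IsGroupIsomorphism)
import Algebra.Properties.Group as GroupProperties
import Algebra.Properties.Ring as RingProperties
import Algebra.Properties.Semiring.Sum as SemiringSum
open import Data.Fin.Base as Fin using (Fin; zero; suc; toℕ; finToFun; funToFin; punchIn; punchOut)
import Data.Fin.Properties as Fin
open import Data.Integer.Base as ℤ using (ℤ; +_; -[1+_])
import Data.Integer.Properties as ℤ
open import Data.List.Base using ([]; _∷_; _++_; foldr)
open import Data.List.Properties using (foldr-++)
import Data.Nat.Properties as ℕ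
open import Data.Product.Base using (Σ; ∃; ∃₂; _×_; _,_; proj₁; proj₂)
open import Data.Rational.Base as ℚ using (ℚ; 0ℚ; 1ℚ; ½; *≤*)
import Data.Rational.Literals as Literals
import Data.Rational.Properties as ℚ
open import Data.Rational.Solver using (module +-*-Solver)
open import Data.Sum.Base using (_⊎_; inj₁; inj₂)
open import Data.Vec.Functional using (Vector)
open import Function.Base using (_∘_)
open import Function.Bundles using (Equivalence)
open import Relation.Binary.Definitions using (Decidable)
open import Relation.Binary.PropositionalEquality as ≡ using (_≡_)
open import Relation.Nullary.Decidable.Core using (Dec; yes; no; decidable-stable)
open import Relation.Unary using (_∈_)

-- The obstacle is that only `s` is bounded: `x` and `y` may grow with the scale, and with them the
-- entries `b = s x` and `c = - s y` of the commutator. The two reductions do not interfere: a left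
-- factor `T^u` changes `b` but not `c` or `d`, and a right factor `V^w` changes `c` but not `b` or
-- `d`. The entry `a` is then controlled by `a d = 1 + b c`, because `d` stays away from zero. On
-- the side of the free product the outer factors are harmless as well: each meets a letter of the
-- other kind, so nothing cancels and the normal form still displays `y` and `x`. The scales produce
-- infinitely many pairs because in every coordinate one of `x`, `y` is forced to shrink: `x` in the
-- coordinate zero, `y` in all others. Real numbers are never divided. Each quotient estimate is
-- multiplied by its positive denominator, which explains the scaling factors in the statements
-- below.

-- Normal forms in a free product of two groups

-- Reduced words in A and B that do not begin with a letter of A.
data Reduced {c ℓ} (A B : Group c ℓ) : Set (c ⊔ ℓ) where
  []   : Reduced A B
  cons : (y : Group.Carrier B) → ¬ Group._≈_ B y (Group.ε B) → Reduced B A → Reduced A B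

data _≋_ {c ℓ} {A B : Group c ℓ} : Reduced A B → Reduced A B → Set (c ⊔ ℓ) where
  []   : [] ≋ []
  cons : ∀ {x y x≉ε y≉ε u v} → Group._≈_ B x y → u ≋ v → cons x x≉ε u ≋ cons y y≉ε v

≋-refl : ∀ {c ℓ} {A B : Group c ℓ} {u : Reduced A B} → u ≋ u
≋-refl {u = []} = []
≋-refl {B = B} {u = cons y _ u} = cons (Group.refl B) ≋-refl

≋-sym : ∀ {c ℓ} {A B : Group c ℓ} {u v : Reduced A B} → u ≋ v → v ≋ u
≋-sym [] = []
≋-sym {B = B} (cons p q) = cons (Group.sym B p) (≋-sym q)

≋-trans : ∀ {c ℓ} {A B : Group c ℓ} {u v w : Reduced A B} → u ≋ v → v ≋ w → u ≋ w
≋-trans [] [] = []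
≋-trans {B = B} (cons p q) (cons r s) = cons (Group.trans B p r) (≋-trans q s)

-- A reduced word, split into its (possibly trivial) leading letter from A and the rest.
State : ∀ {c ℓ} (A B : Group c ℓ) → Set (c ⊔ ℓ)
State A B = Group.Carrier A × Reduced A B

infix 4 _≈ₙ_

record _≈ₙ_ {c ℓ} {A B : Group c ℓ} (s t : State A B) : Set (c ⊔ ℓ) where
  constructor _,_
  field
    head≈ : Group._≈_ A (proj₁ s) (proj₁ t)
    tail≋ : proj₂ s ≋ proj₂ t

open _≈ₙ_

≈ₙ-refl : ∀ {c ℓ} {A B : Group c ℓ} {s : State A B} → s ≈ₙ s
≈ₙ-refl {A = A} = Group.refl A , ≋-refl

≈ₙ-sym : ∀ {c ℓ} {A B : Group c ℓ} {s t : State A B} → s ≈ₙ t → t ≈ₙ s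
≈ₙ-sym {A = A} (p , q) = Group.sym A p , ≋-sym q

≈ₙ-trans : ∀ {c ℓ} {A B : Group c ℓ} {s t r : State A B} → s ≈ₙ t → t ≈ₙ r → s ≈ₙ r
≈ₙ-trans {A = A} (p , q) (p′ , q′) = Group.trans A p p′ , ≋-trans q q′

module _ {c ℓ} {A B : Group c ℓ} where
  private
    module A = Group A
    module B = Group B

  flipTrivial : Reduced A B → State B A
  flipTrivial []           = B.ε , []
  flipTrivial (cons y _ u) = y , u

  -- The same reduced word, with its leading slot read in the other factor. The decision is an
  -- argument so that proofs can match on it and compare different decisions.
  flip-with : (s : State A B) → Dec (proj₁ s A.≈ A.ε) → State B A
  flip-with (x , u) (yes _)   = flipTrivial u
  flip-with (x , u) (no x≉ε) = B.ε , cons x x≉ε u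

  flipTrivial-cong : ∀ {u v} → u ≋ v → flipTrivial u ≈ₙ flipTrivial v
  flipTrivial-cong []         = B.refl , []
  flipTrivial-cong (cons p q) = p , q

  flip-with-cong : ∀ {s t} p q → s ≈ₙ t → flip-with s p ≈ₙ flip-with t q
  flip-with-cong (yes _)  (yes _)  (_ , u≋v)   = flipTrivial-cong u≋v
  flip-with-cong (yes p)  (no ¬q)  (x≈y , _)   = contradiction (A.trans (A.sym x≈y) p) ¬q
  flip-with-cong (no ¬p)  (yes q)  (x≈y , _)   = contradiction (A.trans x≈y q) ¬p
  flip-with-cong (no _)   (no _)   (x≈y , u≋v) = B.refl , cons x≈y u≋v

  act : A.Carrier → State A B → State A B
  act x (y , u) = x A.∙ y , u

module _ {c ℓ} {A B : Group c ℓ} where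
  private
    module A = Group A
    module B = Group B

  flip-with-involutive : ∀ (s : State A B) p q → flip-with (flip-with s p) q ≈ₙ s
  flip-with-involutive (x , [])          (yes p) (yes _) = A.sym p , []
  flip-with-involutive (x , [])          (yes _) (no ¬q) = contradiction B.refl ¬q
  flip-with-involutive (x , cons y y≉ε u) (yes _) (yes q) = contradiction q y≉ε
  flip-with-involutive (x , cons y y≉ε u) (yes p) (no _)  = A.sym p , ≋-refl
  flip-with-involutive (x , u)           (no _)  (yes _) = ≈ₙ-refl
  flip-with-involutive (x , u)           (no _)  (no ¬q) = contradiction B.refl ¬q

-- Van der Waerden's action of the free product on the reduced words.
module NormalForm {c ℓ} (A B : Group c ℓ)
  (_≟ᴬ_ : Decidable (Group._≈_ A)) (_≟ᴮ_ : Decidable (Group._≈_ B)) where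

  open FreeProduct A B
  private
    module A = Group A
    module B = Group B

  flipᴬ : State A B → State B A
  flipᴬ s = flip-with s (proj₁ s ≟ᴬ A.ε)

  flipᴮ : State B A → State A B
  flipᴮ s = flip-with s (proj₁ s ≟ᴮ B.ε)

  -- Both factors act by multiplying the leading slot; creation and cancellation of letters happen
  -- only in the flips, so the two factors need no separate treatment.
  apply : A.Carrier ⊎ B.Carrier → State A B → State A B
  apply (inj₁ x) s = act x s
  apply (inj₂ y) s = flipᴮ (act y (flipᴬ s))

  run : Word → State A B → State A B
  run w s = foldr apply s w

  flipᴬ-cong : ∀ {s t} → s ≈ₙ t → flipᴬ s ≈ₙ flipᴬ t
  flipᴬ-cong {s} {t} = flip-with-cong (proj₁ s ≟ᴬ A.ε) (proj₁ t ≟ᴬ A.ε)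

  flipᴮ-cong : ∀ {s t} → s ≈ₙ t → flipᴮ s ≈ₙ flipᴮ t
  flipᴮ-cong {s} {t} = flip-with-cong (proj₁ s ≟ᴮ B.ε) (proj₁ t ≟ᴮ B.ε)

  apply-cong : ∀ x {s t} → s ≈ₙ t → apply x s ≈ₙ apply x t
  apply-cong (inj₁ x) (p , q) = A.∙-congˡ p , q
  apply-cong (inj₂ y) s≈t with flipᴬ-cong s≈t
  ... | p , q = flipᴮ-cong (B.∙-congˡ p , q)

  run-cong : ∀ w {s t} → s ≈ₙ t → run w s ≈ₙ run w t
  run-cong []      s≈t = s≈t
  run-cong (x ∷ w) s≈t = apply-cong x (run-cong w s≈t)

  run-++ : ∀ u v s → run (u ++ v) s ≡ run u (run v s)
  run-++ u v s = foldr-++ apply s u v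

  run-resp : ∀ {u v} → u ∼ v → ∀ s → run u s ≈ₙ run v s
  run-resp ∼-refl        s = ≈ₙ-refl
  run-resp (∼-sym p)     s = ≈ₙ-sym (run-resp p s)
  run-resp (∼-trans p q) s = ≈ₙ-trans (run-resp p s) (run-resp q s)
  run-resp (++-cong {u} {v} {u′} {v′} p q) s
    rewrite run-++ u u′ s | run-++ v v′ s =
      ≈ₙ-trans (run-cong u (run-resp q s)) (run-resp p (run v′ s))
  run-resp (≈ˡ p)   s = A.∙-congʳ p , ≋-refl
  run-resp (∙ˡ x y) s = A.sym (A.assoc x y _) , ≋-refl
  run-resp εˡ       s = A.identityˡ _ , ≋-refl
  run-resp (≈ʳ p)   s = flipᴮ-cong (B.∙-congʳ p , ≋-refl)
  -- Between the two actions of B the state is flipped to A and back, which changes nothing.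
  run-resp (∙ʳ x y) s with flip-with-involutive (act y (flipᴬ s)) (_ ≟ᴮ _) (_ ≟ᴬ _)
  ... | p , q = flipᴮ-cong (B.trans (B.∙-congˡ p) (B.sym (B.assoc x y _)) , q)
  run-resp εʳ       s = ≈ₙ-trans (flipᴮ-cong (B.identityˡ _ , ≋-refl))
    (flip-with-involutive s (_ ≟ᴬ _) (_ ≟ᴮ _))

  -- A nontrivial head `x` is pushed onto the word and leaves an empty slot for B, so `y` has
  -- nothing to merge with.
  apply-inj₂ : ∀ {y x u s} (y≉ε : ¬ y B.≈ B.ε) (x≉ε : ¬ x A.≈ A.ε) → s ≈ₙ (x , u) →
               apply (inj₂ y) s ≈ₙ (A.ε , cons y y≉ε (cons x x≉ε u))
  apply-inj₂ {y} {x} {u} {s} y≉ε x≉ε s≈ =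
    ≈ₙ-trans (apply-cong (inj₂ y) s≈) (flipped (x ≟ᴬ A.ε))
    where
    cancelled : ∀ q → flip-with (y B.∙ B.ε , cons x x≉ε u) q
                        ≈ₙ (A.ε , cons y y≉ε (cons x x≉ε u))
    cancelled (yes q) = contradiction (B.trans (B.sym (B.identityʳ y)) q) y≉ε
    cancelled (no _)  = A.refl , cons (B.identityʳ y) ≋-refl

    flipped : ∀ p → flipᴮ (act y (flip-with (x , u) p))
                      ≈ₙ (A.ε , cons y y≉ε (cons x x≉ε u))
    flipped (yes p) = contradiction p x≉ε
    flipped (no _)  = ≈ₙ-trans (flipᴮ-cong (B.refl , cons A.refl ≋-refl))
                        (cancelled ((y B.∙ B.ε) ≟ᴮ B.ε))

  start : State A B
  start = A.ε , []

  -- Here `y` may be trivial, as the reducing factor on the right can be. Only the empty A-slot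
  -- matters for the letter that follows.
  apply-inj₂-start : ∀ y → ∃ λ u → apply (inj₂ y) start ≈ₙ (A.ε , u)
  apply-inj₂-start y = flipped (A.ε ≟ᴬ A.ε)
    where
    cancelled : ∀ q → ∃ λ u → flip-with (y B.∙ B.ε , []) q ≈ₙ (A.ε , u)
    cancelled (yes _) = _ , ≈ₙ-refl
    cancelled (no _)  = _ , ≈ₙ-refl

    flipped : ∀ p → ∃ λ u → flipᴮ (act y (flip-with start p)) ≈ₙ (A.ε , u)
    flipped (yes _) = cancelled ((y B.∙ B.ε) ≟ᴮ B.ε)
    flipped (no ¬p) = contradiction A.refl ¬p

  act-ε : ∀ {x} {s : State A B} {u} → s ≈ₙ (A.ε , u) → act x s ≈ₙ (x , u)
  act-ε (p , q) = A.trans (A.∙-congˡ p) (A.identityʳ _) , q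

  -- The outer letters `a` and `b` stand for the reducing factors `T^u` and `V^w`; either may be
  -- trivial.
  twisted-commutator : A.Carrier → B.Carrier → A.Carrier → B.Carrier → Word
  twisted-commutator a y x b =
    inj₁ a ∷ inj₂ y ∷ inj₁ x ∷ inj₂ (y B.⁻¹) ∷ inj₁ (x A.⁻¹) ∷ inj₂ b ∷ []

  -- The letter `a` stays in the leading slot even when it is trivial, so `y` and `x` always occupy
  -- the first two places of the reduced word; `b` only influences the tail.
  run-twisted-commutator : ∀ a {y x} b → (y≉ε : ¬ y B.≈ B.ε) (x≉ε : ¬ x A.≈ A.ε) →
    ∃ λ u → run (twisted-commutator a y x b) start ≈ₙ (a , cons y y≉ε (cons x x≉ε u))
  run-twisted-commutator a {y} {x} b y≉ε x≉ε =
    let _ , s₁ = apply-inj₂-start b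
        s₂ = apply-inj₂ (y≉ε ∘ ε⁻¹-unique B) (x≉ε ∘ ε⁻¹-unique A) (act-ε s₁)
        s₃ = apply-inj₂ y≉ε x≉ε (act-ε s₂)
    in _ , act-ε s₃
    where
    ε⁻¹-unique : ∀ (G : Group c ℓ) {z} →
      Group._≈_ G (Group._⁻¹ G z) (Group.ε G) → Group._≈_ G z (Group.ε G)
    ε⁻¹-unique G z⁻¹≈ε = ⁻¹-injective (trans z⁻¹≈ε (sym ε⁻¹≈ε))
      where
      open Group G
      open GroupProperties G

  twisted-commutator-injective : ∀ {a a′ y y′ x x′ b b′} →
    ¬ y B.≈ B.ε → ¬ y′ B.≈ B.ε → ¬ x A.≈ A.ε → ¬ x′ A.≈ A.ε →
    twisted-commutator a y x b ∼ twisted-commutator a′ y′ x′ b′ → x A.≈ x′ × y B.≈ y′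
  twisted-commutator-injective {a} {a′} {b = b} {b′} y≉ε y′≉ε x≉ε x′≉ε w∼w′
    with ≈ₙ-trans (≈ₙ-sym (proj₂ (run-twisted-commutator a b y≉ε x≉ε)))
           (≈ₙ-trans (run-resp w∼w′ start) (proj₂ (run-twisted-commutator a′ b′ y′≉ε x′≉ε)))
  ... | _ , cons y≈y′ (cons x≈x′ _) = x≈x′ , y≈y′

  -- The leading slots differ: it is empty for `y x` and holds `x` for `x y`.
  not-commuting : ∀ {y x} → ¬ y B.≈ B.ε → ¬ x A.≈ A.ε →
                  ¬ inj₂ y ∷ inj₁ x ∷ [] ∼ inj₁ x ∷ inj₂ y ∷ []
  not-commuting {y} {x} y≉ε x≉ε yx∼xy = x≉ε (A.trans (A.sym (head≈ xy)) (A.trans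
      (A.sym (head≈ (run-resp yx∼xy start))) (head≈ yx)))
    where
    yx = apply-inj₂ y≉ε x≉ε (act-ε {s = start} ≈ₙ-refl)
    xy = act-ε {x} (proj₂ (apply-inj₂-start y))

-- Rational estimates

module R = CommutativeRing ℝ-commutativeRing

module ℚ-lemmas where

  p≤∣p∣ : ∀ p → p ℚ.≤ ℚ.∣ p ∣
  p≤∣p∣ p with ℚ.≤-total 0ℚ p
  ... | inj₁ 0≤p = ℚ.≤-reflexive (≡.sym (ℚ.0≤p⇒∣p∣≡p 0≤p))
  ... | inj₂ p≤0 = ℚ.≤-trans p≤0 (ℚ.0≤∣p∣ p)

  ∣p∣<q⇒p<q : ∀ {p q} → ℚ.∣ p ∣ ℚ.< q → p ℚ.< q
  ∣p∣<q⇒p<q {p} = ℚ.≤-<-trans (p≤∣p∣ p)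

  ∣p∣<q⇒-p<q : ∀ {p q} → ℚ.∣ p ∣ ℚ.< q → ℚ.- p ℚ.< q
  ∣p∣<q⇒-p<q {p} {q} ∣p∣<q = ∣p∣<q⇒p<q (≡.subst (ℚ._< q) (≡.sym (ℚ.∣-p∣≡∣p∣ p)) ∣p∣<q)

  half-positive : ∀ {q} → 0ℚ ℚ.< q → 0ℚ ℚ.< ½ ℚ.* q
  half-positive {q} 0<q =
    ℚ.positive⁻¹ (½ ℚ.* q) {{ℚ.pos*pos⇒pos ½ q {{ℚ.positive 0<q}}}}

  -- The fraction `k / 1` is normalised through a gcd and is stuck for a variable `k`; the literal
  -- is a constructor form that computes.
  /1≡ : ∀ k → k ℚ./ 1 ≡ Literals.fromℤ k
  /1≡ k = ℚ.↥p/↧p≡p (Literals.fromℤ k)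

  /1-+ : ∀ k l → (k ℤ.+ l) ℚ./ 1 ≡ (k ℚ./ 1) ℚ.+ (l ℚ./ 1)
  /1-+ k l rewrite /1≡ k | /1≡ l =
    ≡.cong (ℚ._/ 1) (≡.cong₂ ℤ._+_ (≡.sym (ℤ.*-identityʳ k)) (≡.sym (ℤ.*-identityʳ l)))

  /1-* : ∀ k l → (k ℤ.* l) ℚ./ 1 ≡ (k ℚ./ 1) ℚ.* (l ℚ./ 1)
  /1-* k l rewrite /1≡ k | /1≡ l = ≡.refl

  ≤-natural : ∀ p → ∃ λ k → p ℚ.≤ Literals.fromℤ (+ k)
  ≤-natural (ℚ.mkℚ i d-1 _) = ℤ.∣ i ∣ , *≤* (begin
    i ℤ.* + 1                  ≡⟨ ℤ.*-identityʳ i ⟩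
    i                          ≤⟨ i≤∣i∣ i ⟩
    + ℤ.∣ i ∣                  ≤⟨ ℤ.+≤+ (ℕ.m≤m*n ℤ.∣ i ∣ (suc d-1)) ⟩
    + (ℤ.∣ i ∣ ℕ.* suc d-1)    ≡⟨ ℤ.pos-* ℤ.∣ i ∣ (suc d-1) ⟩
    + ℤ.∣ i ∣ ℤ.* + suc d-1    ∎)
    where
    open ℤ.≤-Reasoning
    i≤∣i∣ : ∀ i → i ℤ.≤ + ℤ.∣ i ∣
    i≤∣i∣ (+ n)    = ℤ.≤-refl
    i≤∣i∣ -[1+ n ] = ℤ.-≤+

  archimedean : ∀ p {q} → 0ℚ ℚ.< q → ∃ λ k → p ℚ.≤ (+ k) ℚ./ 1 ℚ.* q
  archimedean p {q} 0<q = k , (begin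
    p                              ≡⟨ ℚ.*-identityʳ p ⟨
    p ℚ.* 1ℚ                       ≡⟨ ≡.cong (p ℚ.*_) (ℚ.*-inverseˡ q) ⟨
    p ℚ.* (ℚ.1/ q ℚ.* q)           ≡⟨ ℚ.*-assoc p (ℚ.1/ q) q ⟨
    p ℚ.* ℚ.1/ q ℚ.* q             ≤⟨ ℚ.*-monoʳ-≤-nonNeg q (proj₂ k≥) ⟩
    Literals.fromℤ (+ k) ℚ.* q     ≡⟨ ≡.cong (ℚ._* q) (/1≡ (+ k)) ⟨
    (+ k) ℚ./ 1 ℚ.* q              ∎)
    where
    open ℚ.≤-Reasoning
    instance
      q-positive : ℚ.Positive q
      q-positive = ℚ.positive 0<q
      q-nonZero : ℚ.NonZero q
      q-nonZero = ℚ.pos⇒nonZero q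
      q-nonNeg : ℚ.NonNegative q
      q-nonNeg = ℚ.pos⇒nonNeg q
    k≥ = ≤-natural (p ℚ.* ℚ.1/ q)
    k = proj₁ k≥

open ℚ-lemmas

-- Positivity of Cauchy reals, the Archimedean property and trichotomy

pointwise : ∀ {x y} → (∀ n → seq x n ≡ seq y n) → x ≈ y
pointwise {x} {y} eq = mk≈ λ ε 0<ε → 0 , λ n _ →
  ≡.subst (λ t → ℚ.∣ t ∣ ℚ.< ε)
    (≡.trans (≡.sym (ℚ.+-inverseʳ (seq x n))) (≡.cong (λ t → seq x n ℚ.- t) (eq n)))
    0<ε

Pos : ℝ → Set
Pos x = 0ℝ < x

eventually⇒pos : ∀ {x} q → 0ℚ ℚ.< q → ∀ N → (∀ n → N ℕ.≤ n → q ℚ.< seq x n) → Pos x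
eventually⇒pos {x} q 0<q N q<x = mk< q 0<q N λ n N≤n →
  ≡.subst (ℚ._< seq x n) (≡.sym (ℚ.+-identityˡ q)) (q<x n N≤n)

pos⇒eventually : ∀ {x} (0<x : Pos x) → ∀ n → _<_.from 0<x ℕ.≤ n → _<_.gap 0<x ℚ.< seq x n
pos⇒eventually {x} 0<x n N≤n =
  ≡.subst (ℚ._< seq x n) (ℚ.+-identityˡ (_<_.gap 0<x)) (_<_.eventually 0<x n N≤n)

pos⇒< : ∀ {x y} → Pos (y - x) → x < y
pos⇒< {x} {y} 0<y-x@(mk< q 0<q N _) = mk< q 0<q N λ n N≤n →
  ≡.subst₂ ℚ._<_ (ℚ.+-comm q (seq x n))
    (≡.trans (≡.cong (ℚ._+ seq x n) (≡.trans (seq-+ y (- x) n) (≡.cong (seq y n ℚ.+_) (seq-neg x n))))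
      (cancel (seq y n) (seq x n)))
    (ℚ.+-monoˡ-< (seq x n) (pos⇒eventually 0<y-x n N≤n))
  where
  open +-*-Solver
  cancel : ∀ a b → (a ℚ.- b) ℚ.+ b ≡ a
  cancel = solve 2 (λ a b → (a :- b) :+ b := a) ≡.refl

pos-resp : ∀ {x y} → x ≈ y → Pos x → Pos y
pos-resp {x} {y} x≈y 0<x@(mk< q 0<q M _) with null x≈y (½ ℚ.* q) (half-positive 0<q)
... | N , close = eventually⇒pos (½ ℚ.* q) (half-positive 0<q) (M ℕ.⊔ N) λ n M⊔N≤n →
  ≡.subst₂ ℚ._<_ (halves q) (cancel (seq x n) (seq y n))
    (ℚ.+-mono-< (pos⇒eventually 0<x n (ℕ.m⊔n≤o⇒m≤o M N M⊔N≤n))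
      (ℚ.neg-antimono-< (∣p∣<q⇒p<q (close n (ℕ.m⊔n≤o⇒n≤o M N M⊔N≤n)))))
  where
  open +-*-Solver
  halves : ∀ q → q ℚ.+ ℚ.- (½ ℚ.* q) ≡ ½ ℚ.* q
  halves = solve 1 (λ q → q :+ :- (con ½ :* q) := con ½ :* q) ≡.refl
  cancel : ∀ a b → a ℚ.+ ℚ.- (a ℚ.- b) ≡ b
  cancel = solve 2 (λ a b → a :+ :- (a :- b) := b) ≡.refl

pos-+ : ∀ {x y} → Pos x → Pos y → Pos (x + y)
pos-+ {x} {y} 0<x@(mk< q 0<q M _) 0<y@(mk< r 0<r N _) =
  eventually⇒pos (q ℚ.+ r) (ℚ.+-mono-< 0<q 0<r) (M ℕ.⊔ N) λ n M⊔N≤n →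
    ≡.subst (q ℚ.+ r ℚ.<_) (≡.sym (seq-+ x y n))
      (ℚ.+-mono-< (pos⇒eventually 0<x n (ℕ.m⊔n≤o⇒m≤o M N M⊔N≤n))
                  (pos⇒eventually 0<y n (ℕ.m⊔n≤o⇒n≤o M N M⊔N≤n)))

pos-* : ∀ {x y} → Pos x → Pos y → Pos (x * y)
pos-* {x} {y} 0<x@(mk< q 0<q M _) 0<y@(mk< r 0<r N _) =
  eventually⇒pos (q ℚ.* r) (ℚ.positive⁻¹ (q ℚ.* r) {{ℚ.pos*pos⇒pos q r}}) (M ℕ.⊔ N) λ n M⊔N≤n →
    let q<x = pos⇒eventually 0<x n (ℕ.m⊔n≤o⇒m≤o M N M⊔N≤n)
        r<y = pos⇒eventually 0<y n (ℕ.m⊔n≤o⇒n≤o M N M⊔N≤n)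
        instance
          x-positive : ℚ.Positive (seq x n)
          x-positive = ℚ.positive (ℚ.<-trans 0<q q<x)
    in ≡.subst (q ℚ.* r ℚ.<_) (≡.sym (seq-* x y n))
         (ℚ.<-trans (ℚ.*-monoˡ-<-pos r q<x) (ℚ.*-monoʳ-<-pos (seq x n) r<y))
  where
  instance
    q-positive : ℚ.Positive q
    q-positive = ℚ.positive 0<q
    r-positive : ℚ.Positive r
    r-positive = ℚ.positive 0<r

¬pos-0 : ¬ Pos 0ℝ
¬pos-0 0<0@(mk< q 0<q N _) = ℚ.<-asym 0<q (pos⇒eventually 0<0 N ℕ.≤-refl)

pos-1 : Pos 1ℝ
pos-1 = eventually⇒pos ½ (ℚ.positive⁻¹ ½) 0 λ _ _ → ℚ.*<* (ℤ.+<+ (ℕ.s<s ℕ.z<s))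

-- Opaque so that unification does not evaluate the rational arithmetic in fromℤ.
opaque
  ι : ℕ → ℝ
  ι n = fromℤ (+ n)

  ι-fromℤ : ∀ n → ι n ≈ fromℤ (+ n)
  ι-fromℤ n = R.refl

  seq-ι : ∀ k n → seq (ι k) n ≡ (+ k) ℚ./ 1
  seq-ι k n = ≡.refl

fromℤ-+ : ∀ k l → fromℤ (k ℤ.+ l) ≈ fromℤ k + fromℤ l
fromℤ-+ k l = pointwise λ n → ≡.trans (/1-+ k l) (≡.sym (seq-+ (fromℤ k) (fromℤ l) n))

fromℤ-* : ∀ k l → fromℤ (k ℤ.* l) ≈ fromℤ k * fromℤ l
fromℤ-* k l = pointwise λ n → ≡.trans (/1-* k l) (≡.sym (seq-* (fromℤ k) (fromℤ l) n))

fromℚ-injective : ∀ {p q} → fromℚ p ≈ fromℚ q → p ≡ q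
fromℚ-injective {p} {q} p≈q with 0ℚ ℚ.<? ℚ.∣ p ℚ.- q ∣
-- The difference is a constant sequence, so it cannot fall below itself.
... | yes 0<∣p-q∣ with null p≈q _ 0<∣p-q∣
...   | N , close = contradiction (close N ℕ.≤-refl) (ℚ.<-irrefl ≡.refl)
fromℚ-injective {p} {q} p≈q | no ∣p-q∣≯0 =
  x∙y⁻¹≈ε⇒x≈y p q (ℚ.∣p∣≡0⇒p≡0 (p ℚ.- q) (ℚ.≤-antisym (ℚ.≮⇒≥ ∣p-q∣≯0) (ℚ.0≤∣p∣ (p ℚ.- q))))
  where open GroupProperties ℚ.+-0-group

fromℤ-injective : ∀ {k l} → fromℤ k ≈ fromℤ l → k ≡ l
fromℤ-injective {k} {l} k≈l = ≡.cong ℚ.numerator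
  (≡.trans (≡.sym (/1≡ k)) (≡.trans (fromℚ-injective k≈l) (/1≡ l)))

eventually-bounded : ∀ x → ∃ λ B → ∃ λ N → ∀ n → N ℕ.≤ n → seq x n ℚ.< B
eventually-bounded x with cauchy x 1ℚ (ℚ.positive⁻¹ 1ℚ)
... | N , close = 1ℚ ℚ.+ seq x N , N , λ n N≤n →
  ≡.subst (ℚ._< 1ℚ ℚ.+ seq x N) (cancel (seq x n) (seq x N))
    (ℚ.+-monoˡ-< (seq x N) (∣p∣<q⇒p<q (close n N N≤n ℕ.≤-refl)))
  where
  open +-*-Solver
  cancel : ∀ a b → (a ℚ.- b) ℚ.+ b ≡ a
  cancel = solve 2 (λ a b → (a :- b) :+ b := a) ≡.refl

archimedes : ∀ {w} → Pos w → ∀ x → ∃ λ k → Pos (ι k * w - x)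
archimedes {w} 0<w@(mk< q 0<q M _) x =
  k , eventually⇒pos 1ℚ (ℚ.positive⁻¹ 1ℚ) (M ℕ.⊔ N) λ n M⊔N≤n →
    ≡.subst₂ ℚ._<_ (cancel B) (≡.sym (value n))
      (ℚ.+-mono-≤-<
        (ℚ.≤-trans (proj₂ large) (ℚ.*-monoˡ-≤-nonNeg ((+ k) ℚ./ 1) {{k-nonNeg}}
          (ℚ.<⇒≤ (pos⇒eventually 0<w n (ℕ.m⊔n≤o⇒m≤o M N M⊔N≤n)))))
        (ℚ.neg-antimono-< (proj₂ (proj₂ bound) n (ℕ.m⊔n≤o⇒n≤o M N M⊔N≤n))))
  where
  open +-*-Solver
  bound = eventually-bounded x
  B = proj₁ bound
  N = proj₁ (proj₂ bound)
  -- The additional 1 becomes the gap that positivity demands.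
  large = archimedean (1ℚ ℚ.+ B) 0<q
  k = proj₁ large
  k-nonNeg : ℚ.NonNegative ((+ k) ℚ./ 1)
  k-nonNeg = ≡.subst ℚ.NonNegative (≡.sym (/1≡ (+ k))) _
  cancel : ∀ b → 1ℚ ℚ.+ b ℚ.+ ℚ.- b ≡ 1ℚ
  cancel = solve 1 (λ b → con 1ℚ :+ b :+ :- b := con 1ℚ) ≡.refl
  value : ∀ n → seq (ι k * w - x) n ≡ (+ k) ℚ./ 1 ℚ.* seq w n ℚ.+ ℚ.- seq x n
  value n = ≡.trans (seq-+ (ι k * w) (- x) n) (≡.cong₂ ℚ._+_ (≡.trans (seq-* (ι k) w n) (≡.cong (ℚ._* seq w n) (seq-ι k n))) (seq-neg x n))

-- If neither sign is positive, the sequence is null: from some `N` on it varies by less than `ε/4`,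
-- so `∣x_N∣ ≥ ε/2` would leave a permanent gap of `ε/4` on one side of zero.
trichotomy : ExcludedMiddle 0ℓ → ∀ x → Pos x ⊎ x ≈ 0ℝ ⊎ Pos (- x)
trichotomy em x with em {Pos x} | em {Pos (- x)}
... | yes 0<x | _         = inj₁ 0<x
... | no _    | yes 0<-x  = inj₂ (inj₂ 0<-x)
... | no ¬0<x | no ¬0<-x = inj₂ (inj₁ (mk≈ small))
  where
  open +-*-Solver
  close-below : ∀ a b → a ℚ.+ ℚ.- (a ℚ.- b) ≡ b
  close-below = solve 2 (λ a b → a :+ :- (a :- b) := b) ≡.refl
  minus-0 : ∀ a b → b ℚ.- a ℚ.+ a ≡ b ℚ.- 0ℚ
  minus-0 = solve 2 (λ a b → b :- a :+ a := b :- con 0ℚ) ≡.refl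
  half : ∀ q → ½ ℚ.* q ℚ.+ ℚ.- (½ ℚ.* (½ ℚ.* q)) ≡ ½ ℚ.* (½ ℚ.* q)
  half = solve 1 (λ q → con ½ :* q :+ :- (con ½ :* (con ½ :* q)) := con ½ :* (con ½ :* q)) ≡.refl
  two-halves : ∀ q → ½ ℚ.* q ℚ.+ ½ ℚ.* q ≡ q
  two-halves = solve 1 (λ q → con ½ :* q :+ con ½ :* q := q) ≡.refl

  small : ∀ ε → 0ℚ ℚ.< ε → ∃ λ N → ∀ n → N ℕ.≤ n → ℚ.∣ seq x n ℚ.- 0ℚ ∣ ℚ.< ε
  small ε 0<ε with cauchy x (½ ℚ.* (½ ℚ.* ε)) (half-positive (half-positive 0<ε))
  ... | N , close with ℚ.∣ seq x N ∣ ℚ.<? ½ ℚ.* ε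
  ...   | yes small-N = N , λ n N≤n →
    ≡.subst (λ p → ℚ.∣ p ∣ ℚ.< ε) (minus-0 (seq x N) (seq x n))
      (ℚ.≤-<-trans (ℚ.∣p+q∣≤∣p∣+∣q∣ (seq x n ℚ.- seq x N) (seq x N))
        (≡.subst (_ ℚ.<_) (two-halves ε)
          (ℚ.+-mono-< (ℚ.<-trans (close n N N≤n ℕ.≤-refl) quarter<half) small-N)))
    where
    quarter<half : ½ ℚ.* (½ ℚ.* ε) ℚ.< ½ ℚ.* ε
    quarter<half = ≡.subst₂ ℚ._<_ (ℚ.+-identityʳ _) (two-halves (½ ℚ.* ε))
      (ℚ.+-monoʳ-< (½ ℚ.* (½ ℚ.* ε)) (half-positive (half-positive 0<ε)))
  ...   | no ¬small-N with ℚ.∣p∣≡p∨∣p∣≡-p (seq x N) | ℚ.≮⇒≥ ¬small-N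
  ...     | inj₁ ∣x∣≡x | large = contradiction
    (eventually⇒pos (½ ℚ.* (½ ℚ.* ε)) (half-positive (half-positive 0<ε)) N λ n N≤n →
      ≡.subst₂ ℚ._<_ (half ε) (close-below (seq x N) (seq x n))
        (ℚ.+-mono-≤-< (≡.subst (½ ℚ.* ε ℚ.≤_) ∣x∣≡x large)
          (ℚ.neg-antimono-< (∣p∣<q⇒p<q (close N n ℕ.≤-refl N≤n))))) ¬0<x
  ...     | inj₂ ∣x∣≡-x | large = contradiction
    (eventually⇒pos (½ ℚ.* (½ ℚ.* ε)) (half-positive (half-positive 0<ε)) N λ n N≤n →
      ≡.subst₂ ℚ._<_ (half ε)
        (≡.trans (negated (seq x N) (seq x n)) (≡.sym (seq-neg x n)))
        (ℚ.+-mono-≤-< (≡.subst (½ ℚ.* ε ℚ.≤_) ∣x∣≡-x large)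
          (ℚ.neg-antimono-< (∣p∣<q⇒-p<q (close N n ℕ.≤-refl N≤n))))) ¬0<-x
    where
    negated : ∀ a b → ℚ.- a ℚ.+ ℚ.- (ℚ.- (a ℚ.- b)) ≡ ℚ.- b
    negated = solve 2 (λ a b → :- a :+ :- (:- (a :- b)) := :- b) ≡.refl

open ℝ-Solver
open RingProperties R.ring using (-0#≈0#; -‿involutive)
open SemiringSum R.semiring using (sum; sum-cong-≋; ∑-distrib-+; *-distribˡ-sum; *-distribʳ-sum)

-- Inequalities and bounds on absolute values

NonNeg : ℝ → Set
NonNeg x = Pos x ⊎ x ≈ 0ℝ

nonneg-resp : ∀ {x y} → x ≈ y → NonNeg x → NonNeg y
nonneg-resp x≈y (inj₁ 0<x) = inj₁ (pos-resp x≈y 0<x)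
nonneg-resp x≈y (inj₂ x≈0) = inj₂ (R.trans (R.sym x≈y) x≈0)

pos+nonneg : ∀ {x y} → Pos x → NonNeg y → Pos (x + y)
pos+nonneg 0<x (inj₁ 0<y) = pos-+ 0<x 0<y
pos+nonneg 0<x (inj₂ y≈0) = pos-resp (R.sym (R.trans (R.+-congˡ y≈0) (R.+-identityʳ _))) 0<x

nonneg-+ : ∀ {x y} → NonNeg x → NonNeg y → NonNeg (x + y)
nonneg-+ (inj₁ 0<x) 0≤y = inj₁ (pos+nonneg 0<x 0≤y)
nonneg-+ (inj₂ x≈0) 0≤y = nonneg-resp (R.sym (R.trans (R.+-congʳ x≈0) (R.+-identityˡ _))) 0≤y

nonneg-* : ∀ {x y} → NonNeg x → NonNeg y → NonNeg (x * y)
nonneg-* (inj₁ 0<x) (inj₁ 0<y) = inj₁ (pos-* 0<x 0<y)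
nonneg-* (inj₁ _)   (inj₂ y≈0) = inj₂ (R.trans (R.*-congˡ y≈0) (R.zeroʳ _))
nonneg-* (inj₂ x≈0) _          = inj₂ (R.trans (R.*-congʳ x≈0) (R.zeroˡ _))

¬pos∧nonneg- : ∀ {x} → Pos x → ¬ NonNeg (- x)
¬pos∧nonneg- 0<x 0≤-x = ¬pos-0 (pos-resp (R.-‿inverseʳ _) (pos+nonneg 0<x 0≤-x))

infix 4 _◃_

-- x ◃ p stands for ∣x∣ ≤ p.
record _◃_ (x p : ℝ) : Set where
  constructor mk◃
  field
    lower : NonNeg (p + x)
    upper : NonNeg (p - x)

open _◃_

opaque
  unfolding ι

  ι-0 : ι 0 ≈ 0ℝ
  ι-0 = R.refl

  ι-suc : ∀ n → ι (suc n) ≈ 1ℝ + ι n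
  ι-suc n = fromℤ-+ (+ 1) (+ n)

  ι-+ : ∀ m n → ι (m ℕ.+ n) ≈ ι m + ι n
  ι-+ m n = fromℤ-+ (+ m) (+ n)

  ι-* : ∀ m n → ι (m ℕ.* n) ≈ ι m * ι n
  ι-* m n = R.trans (R.reflexive (≡.cong fromℤ (ℤ.pos-* m n))) (fromℤ-* (+ m) (+ n))

ι-1 : ι 1 ≈ 1ℝ
ι-1 = R.trans (ι-suc 0) (R.trans (R.+-congˡ ι-0) (R.+-identityʳ 1ℝ))

ι-nonneg : ∀ n → NonNeg (ι n)
ι-nonneg zero    = inj₂ ι-0
ι-nonneg (suc n) = nonneg-resp (R.sym (ι-suc n)) (nonneg-+ (inj₁ pos-1) (ι-nonneg n))

ι-pos : ∀ n → Pos (ι (suc n))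
ι-pos n = pos-resp (R.sym (ι-suc n)) (pos+nonneg pos-1 (ι-nonneg n))

ι-mono : ∀ {m n} → m ℕ.≤ n → NonNeg (ι n - ι m)
ι-mono {m} {n} m≤n = nonneg-resp (R.trans
    (solve 2 (λ m k → k := m :+ k :- m) R.refl (ι m) (ι (n ℕ.∸ m)))
    (R.+-congʳ (R.trans (R.sym (ι-+ m (n ℕ.∸ m))) (R.reflexive (≡.cong ι (ℕ.m+[n∸m]≡n m≤n))))))
  (ι-nonneg (n ℕ.∸ m))

◃-resp : ∀ {x y p q} → x ≈ y → p ≈ q → x ◃ p → y ◃ q
◃-resp x≈y p≈q (mk◃ l u) =
  mk◃ (nonneg-resp (R.+-cong p≈q x≈y) l) (nonneg-resp (R.+-cong p≈q (R.-‿cong x≈y)) u)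

◃-respˡ : ∀ {x y p} → x ≈ y → x ◃ p → y ◃ p
◃-respˡ x≈y = ◃-resp x≈y R.refl

◃-+ : ∀ {x y p q} → x ◃ p → y ◃ q → x + y ◃ p + q
◃-+ {x} {y} {p} {q} (mk◃ l u) (mk◃ l′ u′) = mk◃
  (nonneg-resp (solve 4 (λ x y p q → (p :+ x) :+ (q :+ y) := (p :+ q) :+ (x :+ y)) R.refl x y p q)
    (nonneg-+ l l′))
  (nonneg-resp (solve 4 (λ x y p q → (p :- x) :+ (q :- y) := (p :+ q) :- (x :+ y)) R.refl x y p q)
    (nonneg-+ u u′))

◃-neg : ∀ {x p} → x ◃ p → - x ◃ p
◃-neg {x} {p} (mk◃ l u) = mk◃ u
  (nonneg-resp (solve 2 (λ x p → p :+ x := p :- (:- x)) R.refl x p) l)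

◃-weaken : ∀ {x p q} → x ◃ p → NonNeg (q - p) → x ◃ q
◃-weaken {x} {p} {q} (mk◃ l u) p≤q = mk◃
  (nonneg-resp (solve 3 (λ x p q → (p :+ x) :+ (q :- p) := q :+ x) R.refl x p q) (nonneg-+ l p≤q))
  (nonneg-resp (solve 3 (λ x p q → (p :- x) :+ (q :- p) := q :- x) R.refl x p q) (nonneg-+ u p≤q))

nonneg⇒◃ : ∀ {p} → NonNeg p → p ◃ p
nonneg⇒◃ 0≤p = mk◃ (nonneg-+ 0≤p 0≤p) (inj₂ (R.-‿inverseʳ _))

1◃1 : 1ℝ ◃ 1ℝ
1◃1 = nonneg⇒◃ (inj₁ pos-1)

0◃ : ∀ {p} → NonNeg p → 0ℝ ◃ p
0◃ 0≤p = mk◃ (nonneg-resp (R.sym (R.+-identityʳ _)) 0≤p) (nonneg-resp (R.sym (R.trans (R.+-congˡ -0#≈0#) (R.+-identityʳ _))) 0≤p)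

fromℤ-- : ∀ k l → fromℤ (k ℤ.- l) ≈ fromℤ k - fromℤ l
fromℤ-- k l = R.trans (solve 2 (λ d l → d := (d :+ l) :- l) R.refl (fromℤ (k ℤ.- l)) (fromℤ l))
  (R.+-congʳ (R.trans (R.sym (fromℤ-+ (k ℤ.- l) l)) (R.reflexive (≡.cong fromℤ (//-rightDividesˡ l k)))))
  where open GroupProperties (AbelianGroup.group ℤ.+-0-abelianGroup)

-- Cancellation, the pigeonhole principle in boxes, and rounding

module Ordered (em : ExcludedMiddle 0ℓ) where

  pos-total : ∀ {x} → ¬ x ≈ 0ℝ → Pos x ⊎ Pos (- x)
  pos-total {x} x≉0 with trichotomy em x
  ... | inj₁ 0<x        = inj₁ 0<x
  ... | inj₂ (inj₁ x≈0) = contradiction x≈0 x≉0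
  ... | inj₂ (inj₂ x<0) = inj₂ x<0

  nonneg-total : ∀ x → NonNeg x ⊎ Pos (- x)
  nonneg-total x with trichotomy em x
  ... | inj₁ 0<x        = inj₁ (inj₁ 0<x)
  ... | inj₂ (inj₁ x≈0) = inj₁ (inj₂ x≈0)
  ... | inj₂ (inj₂ x<0) = inj₂ x<0

  -- Takes the place of division by `e`: a negative `x` would make the product negative.
  nonneg-cancel : ∀ {e x} → Pos e → NonNeg (e * x) → NonNeg x
  nonneg-cancel {e} {x} 0<e 0≤ex with nonneg-total x
  ... | inj₁ 0≤x = 0≤x
  ... | inj₂ x<0 = contradiction
    (nonneg-resp (solve 2 (λ e x → e :* x := :- (e :* (:- x))) R.refl e x) 0≤ex)
    (¬pos∧nonneg- (pos-* 0<e x<0))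

  pos-cancel : ∀ {e x} → Pos e → Pos (e * x) → Pos x
  pos-cancel {e} {x} 0<e 0<ex with nonneg-total (- x)
  ... | inj₁ x≤0 = contradiction
    (nonneg-resp (solve 2 (λ e x → e :* (:- x) := :- (e :* x)) R.refl e x) (nonneg-* (inj₁ 0<e) x≤0))
    (¬pos∧nonneg- 0<ex)
  ... | inj₂ 0<x = pos-resp (-‿involutive x) 0<x

  square-nonneg : ∀ x → NonNeg (x * x)
  square-nonneg x with nonneg-total x
  ... | inj₁ 0≤x = nonneg-* 0≤x 0≤x
  ... | inj₂ x<0 = nonneg-resp (solve 1 (λ x → (:- x) :* (:- x) := x :* x) R.refl x)
    (inj₁ (pos-* x<0 x<0))

  pos-2 : Pos (1ℝ + 1ℝ)
  pos-2 = pos-+ pos-1 pos-1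

  ◃⇒nonneg : ∀ {x p} → x ◃ p → NonNeg p
  ◃⇒nonneg {x} {p} (mk◃ l u) = nonneg-cancel pos-2
    (nonneg-resp (solve 2 (λ x p → (p :+ x) :+ (p :- x) := (con 1ℚ :+ con 1ℚ) :* p) R.refl x p)
      (nonneg-+ l u))

  -- 2 (pq ± xy) = (p - x) (q ± y) + (p + x) (q ∓ y)
  ◃-* : ∀ {x y p q} → x ◃ p → y ◃ q → x * y ◃ p * q
  ◃-* {x} {y} {p} {q} (mk◃ l u) (mk◃ l′ u′) = mk◃
    (nonneg-cancel pos-2 (nonneg-resp
      (solve 4 (λ x y p q → (p :- x) :* (q :- y) :+ (p :+ x) :* (q :+ y)
                              := (con 1ℚ :+ con 1ℚ) :* (p :* q :+ x :* y)) R.refl x y p q)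
      (nonneg-+ (nonneg-* u u′) (nonneg-* l l′))))
    (nonneg-cancel pos-2 (nonneg-resp
      (solve 4 (λ x y p q → (p :- x) :* (q :+ y) :+ (p :+ x) :* (q :- y)
                              := (con 1ℚ :+ con 1ℚ) :* (p :* q :- x :* y)) R.refl x y p q)
      (nonneg-+ (nonneg-* u l′) (nonneg-* l u′))))

  ◃-cancel : ∀ {e x p} → Pos e → e * x ◃ e * p → x ◃ p
  ◃-cancel {e} {x} {p} 0<e (mk◃ l u) = mk◃
    (nonneg-cancel 0<e (nonneg-resp (solve 3 (λ e x p → e :* p :+ e :* x := e :* (p :+ x)) R.refl e x p) l))
    (nonneg-cancel 0<e (nonneg-resp (solve 3 (λ e x p → e :* p :- e :* x := e :* (p :- x)) R.refl e x p) u))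

  bound : ∀ x → ∃ λ b → x ◃ b
  bound x with nonneg-total x
  ... | inj₁ 0≤x = x , nonneg⇒◃ 0≤x
  ... | inj₂ x<0 = - x , ◃-respˡ (-‿involutive x) (◃-neg (nonneg⇒◃ (inj₁ x<0)))

  bounds : ∀ {n} (f : Vector ℝ n) → ∃ λ b → NonNeg b × ∀ i → f i ◃ b
  bounds {zero}  f = 0ℝ , inj₂ R.refl , λ ()
  bounds {suc n} f with bound (f zero) | bounds (f ∘ suc)
  ... | b , f₀◃b | c , 0≤c , f◃c = b + c , nonneg-+ 0≤b 0≤c , λ where
      zero    → ◃-weaken f₀◃b (nonneg-resp (solve 2 (λ b c → c := b :+ c :- b) R.refl b c) 0≤c)
      (suc i) → ◃-weaken (f◃c i) (nonneg-resp (solve 2 (λ b c → b := b :+ c :- c) R.refl b c) 0≤b)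
    where 0≤b = ◃⇒nonneg f₀◃b

  bounds₂ : ∀ {m n} (f : Fin m → Fin n → ℝ) → ∃ λ b → NonNeg b × ∀ i j → f i j ◃ b
  bounds₂ f with bounds (λ i → proj₁ (bounds (f i)))
  ... | b , 0≤b , rows◃b = b , 0≤b , λ i j → ◃-weaken (proj₂ (proj₂ (bounds (f i))) j) (upper (rows◃b i))

  ◃-sum : ∀ {n} {f g : Vector ℝ n} → (∀ i → f i ◃ g i) → sum f ◃ sum g
  ◃-sum {zero}  f◃g = 0◃ (inj₂ R.refl)
  ◃-sum {suc n} f◃g = ◃-+ (f◃g zero) (◃-sum (f◃g ∘ suc))

  ◃0⇒≈0 : ∀ {x} → x ◃ 0ℝ → x ≈ 0ℝ
  ◃0⇒≈0 {x} (mk◃ l u) with trichotomy em x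
  ... | inj₁ 0<x        = contradiction (nonneg-resp (R.+-identityˡ _) u) (¬pos∧nonneg- 0<x)
  ... | inj₂ (inj₁ x≈0) = x≈0
  ... | inj₂ (inj₂ x<0) = contradiction
    (nonneg-resp (R.trans (R.+-identityˡ x) (R.sym (-‿involutive x))) l) (¬pos∧nonneg- x<0)

  *-cancel-0 : ∀ {x y} → ¬ x ≈ 0ℝ → x * y ≈ 0ℝ → y ≈ 0ℝ
  *-cancel-0 {x} {y} x≉0 xy≈0 with pos-total x≉0
  ... | inj₁ 0<x = ◃0⇒≈0 (◃-cancel 0<x
    (◃-resp (R.sym xy≈0) (R.sym (R.zeroʳ x)) (0◃ (inj₂ R.refl))))
  ... | inj₂ x<0 = ◃0⇒≈0 (◃-cancel x<0
    (◃-resp (R.trans (R.sym -0#≈0#) (R.trans (R.-‿cong (R.sym xy≈0))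
      (solve 2 (λ x y → :- (x :* y) := (:- x) :* y) R.refl x y))) (R.sym (R.zeroʳ (- x)))
      (0◃ (inj₂ R.refl))))

  pos⇒≉0 : ∀ {x} → Pos x → ¬ x ≈ 0ℝ
  pos⇒≉0 0<x x≈0 = ¬pos-0 (pos-resp x≈0 0<x)

  from-0 : ∀ w y → y ≈ y - ι 0 * w
  from-0 w y = R.trans (solve 2 (λ w y → y := y :- con 0ℚ :* w) R.refl w y)
    (R.+-congˡ (R.-‿cong (R.*-congʳ (R.sym ι-0))))

  -- A bounded search that subtracts `w` repeatedly. The a priori upper bound ends it, so `w` may be
  -- zero. The cells are closed; on a common boundary the lower one is chosen.
  floor : ∀ m {w} → NonNeg w → ∀ y → NonNeg y → NonNeg (ι (suc m) * w - y) →
          ∃ λ (k : Fin (suc m)) → NonNeg (y - ι (toℕ k) * w) × NonNeg (ι (suc (toℕ k)) * w - y)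
  floor zero {w} 0≤w y 0≤y y≤ =
    zero , nonneg-resp (from-0 w y) 0≤y , y≤
  floor (suc m) {w} 0≤w y 0≤y y≤ with nonneg-total (w - y)
  ... | inj₁ y≤w = zero ,
    nonneg-resp (from-0 w y) 0≤y ,
    nonneg-resp (R.+-congʳ (R.trans (R.sym (R.*-identityˡ w)) (R.*-congʳ (R.sym ι-1)))) y≤w
  ... | inj₂ w<y = suc k ,
    nonneg-resp (R.trans (solve 3 (λ k w y → y :- w :- k :* w := y :- (con 1ℚ :+ k) :* w) R.refl (ι (toℕ k)) w y)
      (R.+-congˡ (R.-‿cong (R.*-congʳ (R.sym (ι-suc (toℕ k))))))) (proj₁ (proj₂ rest)) ,
    nonneg-resp (step (suc (toℕ k))) (proj₂ (proj₂ rest))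
    where
    step : ∀ k → ι k * w - (y - w) ≈ ι (suc k) * w - y
    step k = R.trans (solve 3 (λ k w y → k :* w :- (y :- w) := (con 1ℚ :+ k) :* w :- y) R.refl (ι k) w y)
      (R.+-congʳ (R.*-congʳ (R.sym (ι-suc k))))
    rest = floor m 0≤w (y - w)
      (nonneg-resp (solve 2 (λ w y → :- (w :- y) := y :- w) R.refl w y) (inj₁ w<y))
      (nonneg-resp (R.sym (step (suc m))) y≤)
    k = proj₁ rest

  -- p lies in the k-th of the cells of length w + w that start at - ι m * w.
  InCell : ℕ → ℝ → ℝ → ℕ → Set
  InCell m w p k = NonNeg (ι m * w + p - ι k * (w + w)) × NonNeg (ι (suc k) * (w + w) - (ι m * w + p))

  cell : ∀ m {w p} → NonNeg w → p ◃ ι (suc m) * w → ∃ λ (k : Fin (suc m)) → InCell (suc m) w p (toℕ k)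
  cell m {w} {p} 0≤w (mk◃ l u) = floor m (nonneg-+ 0≤w 0≤w) (ι (suc m) * w + p) l
    (nonneg-resp (solve 3 (λ k w p → k :* w :- p := k :* (w :+ w) :- (k :* w :+ p)) R.refl (ι (suc m)) w p) u)

  same-cell⇒◃ : ∀ {m w p q} k → InCell m w p k → InCell m w q k → p - q ◃ w + w
  same-cell⇒◃ {m} {w} {p} {q} k (k≤p , p≤k) (k≤q , q≤k) = mk◃
    (nonneg-resp (width p q) (nonneg-+ k≤p q≤k))
    (nonneg-resp (R.trans (width q p) (solve 3 (λ w p q → (w :+ w) :+ (q :- p) := (w :+ w) :- (p :- q)) R.refl w p q))
      (nonneg-+ k≤q p≤k))
    where
    width : ∀ p q → (ι m * w + p - ι k * (w + w)) + (ι (suc k) * (w + w) - (ι m * w + q)) ≈ (w + w) + (p - q)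
    width p q = R.trans (R.+-congˡ (R.+-congʳ (R.*-congʳ (ι-suc k))))
      (solve 5 (λ m w k p q → (m :* w :+ p :- k :* (w :+ w)) :+ ((con 1ℚ :+ k) :* (w :+ w) :- (m :* w :+ q))
                                := (w :+ w) :+ (p :- q)) R.refl (ι m) w (ι k) p q)

  -- Every coordinate ranges over an interval of length `2mw`, cut into `m` cells of length `2w`;
  -- `funToFin` numbers the resulting `m ^ r` boxes.
  box-pigeonhole : ∀ {r K w} m .{{_ : ℕ.NonZero m}} → NonNeg w → m ℕ.^ r ℕ.< K →
    (p : Fin K → Fin r → ℝ) → (∀ k i → p k i ◃ ι m * w) →
    ∃₂ λ k l → k Fin.< l × ∀ i → p k i - p l i ◃ w + w
  box-pigeonhole {r} {K} {w} (suc m) 0≤w m^r<K p p◃ =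
    let k , l , k<l , eq = Fin.pigeonhole m^r<K (λ k → funToFin (proj₁ ∘ index k)) in
    k , l , k<l , λ i → same-cell⇒◃ (toℕ (proj₁ (index l i)))
      (≡.subst (InCell (suc m) w (p k i) ∘ toℕ) (same k l eq i) (proj₂ (index k i))) (proj₂ (index l i))
    where
    index : ∀ k i → ∃ λ (c : Fin (suc m)) → InCell (suc m) w (p k i) (toℕ c)
    index k i = cell m 0≤w (p◃ k i)
    same : ∀ k l → funToFin (proj₁ ∘ index k) ≡ funToFin (proj₁ ∘ index l) →
           ∀ i → proj₁ (index k i) ≡ proj₁ (index l i)
    same k l eq i = ≡.trans (≡.sym (Fin.finToFun-funToFin (proj₁ ∘ index k) i))
      (≡.trans (≡.cong (λ c → finToFun c i) eq) (Fin.finToFun-funToFin (proj₁ ∘ index l) i))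

  round : ∀ {e} → Pos e → ∀ c → ∃ λ (m : ℤ) → c + fromℤ m * e ◃ e
  round {e} 0<e c = + M ℤ.- + toℕ k , mk◃
    (nonneg-resp (R.trans
        (solve 4 (λ M e c k → e :+ (M :* e :+ c :- k :* e) := e :+ (c :+ (M :- k) :* e)) R.refl (ι M) e c (ι (toℕ k)))
        (R.+-congˡ (R.+-congˡ (R.*-congʳ (R.sym difference)))))
      (nonneg-+ (inj₁ 0<e) (proj₁ (proj₂ k≤))))
    (nonneg-resp (R.trans (R.+-congʳ (R.*-congʳ (ι-suc (toℕ k)))) (R.trans
        (solve 4 (λ M e c k → (con 1ℚ :+ k) :* e :- (M :* e :+ c) := e :- (c :+ (M :- k) :* e)) R.refl (ι M) e c (ι (toℕ k)))
        (R.+-congˡ (R.-‿cong (R.+-congˡ (R.*-congʳ (R.sym difference)))))))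
      (proj₂ (proj₂ k≤)))
    where
    multiple = archimedes 0<e (proj₁ (bound c))
    M = proj₁ multiple
    c◃Me : c ◃ ι M * e
    c◃Me = ◃-weaken (proj₂ (bound c)) (inj₁ (proj₂ multiple))
    ι-2M+1 : ι (suc (M ℕ.+ M)) ≈ 1ℝ + (ι M + ι M)
    ι-2M+1 = R.trans (ι-suc (M ℕ.+ M)) (R.+-congˡ (ι-+ M M))
    -- The shifted value `M e + c` lies in `[0, 2 M e]`; `floor` counts from one, so there is one
    -- cell to spare.
    k≤ = floor (M ℕ.+ M) (inj₁ 0<e) (ι M * e + c) (lower c◃Me)
      (nonneg-resp (R.trans
          (solve 3 (λ M e c → (M :* e :- c) :+ e := (con 1ℚ :+ (M :+ M)) :* e :- (M :* e :+ c)) R.refl (ι M) e c)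
          (R.+-congʳ (R.*-congʳ (R.sym ι-2M+1))))
        (nonneg-+ (upper c◃Me) (inj₁ 0<e)))
    k = proj₁ k≤
    difference : fromℤ (+ M ℤ.- + toℕ k) ≈ ι M - ι (toℕ k)
    difference = R.trans (fromℤ-- (+ M) (+ toℕ k))
      (R.+-cong (R.sym (ι-fromℤ M)) (R.-‿cong (R.sym (ι-fromℤ (toℕ k)))))

-- Linear algebra, cocompactness of lattices and Dirichlet's principle

sum-0 : ∀ {n} {f : Vector ℝ n} → (∀ i → f i ≈ 0ℝ) → sum f ≈ 0ℝ
sum-0 {zero}  f≈0 = R.refl
sum-0 {suc n} f≈0 = R.trans (R.+-cong (f≈0 zero) (sum-0 (f≈0 ∘ suc))) (R.+-identityˡ 0ℝ)

combination-neg : ∀ {n} (c : Fin n → ℝ) (b : Fin n → Vector ℝ n) j →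
  combination (λ i → - c i) b j ≈ - combination c b j
combination-neg c b j = R.trans
  (sum-cong-≋ λ i → solve 2 (λ c b → (:- c) :* b := (:- con 1ℚ) :* (c :* b)) R.refl (c i) (b i j))
  (R.trans (R.sym (*-distribˡ-sum (- 1ℝ) (λ i → c i * b i j)))
    (solve 1 (λ s → (:- con 1ℚ) :* s := :- s) R.refl (combination c b j)))

combination-+ : ∀ {n} (c d : Fin n → ℝ) (b : Fin n → Vector ℝ n) j →
  combination (λ i → c i + d i) b j ≈ combination c b j + combination d b j
combination-+ c d b j = R.trans (sum-cong-≋ λ i → R.distribʳ (b i j) (c i) (d i))
  (∑-distrib-+ (λ i → c i * b i j) (λ i → d i * b i j))

module Lattices (em : ExcludedMiddle 0ℓ) where
  open Ordered em

  -- Gaussian elimination with a pivot from the first vector. The other vectors are cross-multiplied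
  -- with the pivot instead of being divided by it, and the induction runs over the remaining
  -- columns. If the first vector is zero, it is a relation by itself.
  dependent : ∀ n (a : Fin (suc n) → Vector ℝ n) →
    ∃ λ (κ : Fin (suc n) → ℝ) → (∃ λ i → ¬ κ i ≈ 0ℝ) × ∀ j → sum (λ i → κ i * a i j) ≈ 0ℝ
  dependent zero    a = (λ _ → 1ℝ) , (zero , pos⇒≉0 pos-1) , λ ()
  dependent (suc n) a with em {∃ λ j → ¬ a zero j ≈ 0ℝ}
  ... | no a₀≈0 = κ , (zero , pos⇒≉0 pos-1) , λ j →
    R.trans (R.+-cong (R.trans (R.*-identityˡ _) (decidable-stable em λ a₀j≉0 → a₀≈0 (j , a₀j≉0)))
                      (sum-0 λ i → R.zeroˡ (a (suc i) j)))
            (R.+-identityˡ 0ℝ)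
    where
    κ : Fin (suc (suc n)) → ℝ
    κ zero    = 1ℝ
    κ (suc _) = 0ℝ
  ... | yes (p , pivot≉0) = κ , (suc (proj₁ nonzero) , c≉0) , vanishing
    where
    pivot = a zero p

    eliminated : Fin (suc n) → Vector ℝ (suc n)
    eliminated i j = pivot * a (suc i) j - a (suc i) p * a zero j

    rest = dependent n (λ i → eliminated i ∘ punchIn p)
    κ′ = proj₁ rest
    nonzero = proj₁ (proj₂ rest)

    κ : Fin (suc (suc n)) → ℝ
    κ zero    = - sum (λ i → κ′ i * a (suc i) p)
    κ (suc i) = κ′ i * pivot

    c≉0 : ¬ κ (suc (proj₁ nonzero)) ≈ 0ℝ
    c≉0 c≈0 = pivot≉0 (*-cancel-0 (proj₂ nonzero) c≈0)

    vanishing′ : ∀ j → sum (λ i → κ′ i * eliminated i j) ≈ 0ℝ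
    vanishing′ j with p Fin.≟ j
    -- The pivot column is eliminated identically, so it needs nothing from the induction.
    ... | yes ≡.refl = sum-0 λ i →
      solve 3 (λ κ x y → κ :* (x :* y :- y :* x) := con 0ℚ) R.refl (κ′ i) pivot (a (suc i) p)
    ... | no p≢j = ≡.subst (λ j → sum (λ i → κ′ i * eliminated i j) ≈ 0ℝ)
      (Fin.punchIn-punchOut p≢j) (proj₂ (proj₂ rest) (punchOut p≢j))

    vanishing : ∀ j → sum (λ i → κ i * a i j) ≈ 0ℝ
    vanishing j = R.trans
      (R.+-congʳ (R.trans
        (solve 2 (λ s y → (:- s) :* y := s :* (:- y)) R.refl (sum (λ i → κ′ i * a (suc i) p)) (a zero j))
        (*-distribʳ-sum (- a zero j) (λ i → κ′ i * a (suc i) p))))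
      (R.trans (R.sym (∑-distrib-+ (λ i → κ′ i * a (suc i) p * (- a zero j)) (λ i → κ (suc i) * a (suc i) j)))
        (R.trans (sum-cong-≋ λ i →
          solve 5 (λ κ q y p x → κ :* q :* (:- y) :+ κ :* p :* x := κ :* (p :* x :- q :* y)) R.refl
            (κ′ i) (a (suc i) p) (a zero j) pivot (a (suc i) j))
          (vanishing′ j)))

  Independent : ∀ {n} → (Fin n → Vector ℝ n) → Set
  Independent b = ∀ κ → (∀ j → combination κ b j ≈ 0ℝ) → ∀ i → κ i ≈ 0ℝ

  -- Division-free form of the fact that independent vectors span.
  spanning : ∀ {n} {b : Fin n → Vector ℝ n} → Independent b → ∀ z →
    ∃ λ e → Pos e × ∃ λ (κ : Fin n → ℝ) → ∀ j → e * z j ≈ combination κ b j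
  spanning {n} {b} independent z = coordinates (pos-total c₀≉0)
    where
    family : Fin (suc n) → Vector ℝ n
    family zero    = z
    family (suc i) = b i
    relation = dependent n family
    κ₀ = proj₁ relation zero
    κ  = proj₁ relation ∘ suc
    vanishing : ∀ j → κ₀ * z j + combination κ b j ≈ 0ℝ
    vanishing = proj₂ (proj₂ relation)

    c₀≉0 : ¬ κ₀ ≈ 0ℝ
    c₀≉0 c₀≈0 = impossible (proj₁ (proj₂ relation))
      where
      c≈0 : ∀ i → κ i ≈ 0ℝ
      c≈0 = independent κ λ j → R.trans
        (R.trans (R.sym (R.+-identityˡ _))
          (R.+-congʳ (R.sym (R.trans (R.*-congʳ c₀≈0) (R.zeroˡ (z j))))))
        (vanishing j)
      impossible : ¬ ∃ λ i → ¬ proj₁ relation i ≈ 0ℝ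
      impossible (zero  , c≉0) = c≉0 c₀≈0
      impossible (suc i , c≉0) = c≉0 (c≈0 i)

    -- The relation is solved for `z` with the sign that makes the common denominator `e` positive.
    coordinates : Pos κ₀ ⊎ Pos (- κ₀) → ∃ λ e → Pos e × ∃ λ (κ : Fin n → ℝ) → ∀ j → e * z j ≈ combination κ b j
    coordinates (inj₁ 0<κ₀) = κ₀ , 0<κ₀ , (λ i → - κ i) , λ j →
      R.trans (R.trans (solve 2 (λ x y → x := (x :+ y) :- y) R.refl (κ₀ * z j) (combination κ b j))
                (R.trans (R.+-congʳ (vanishing j)) (R.+-identityˡ _)))
        (R.sym (combination-neg κ b j))
    coordinates (inj₂ c₀<0) = - κ₀ , c₀<0 , κ , λ j →
      R.trans (solve 3 (λ x z y → (:- x) :* z := y :- (x :* z :+ y)) R.refl κ₀ (z j) (combination κ b j))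
        (R.trans (R.+-congˡ (R.-‿cong (vanishing j)))
          (R.trans (R.+-congˡ -0#≈0#) (R.+-identityʳ _)))

  module _ {n} (L : Lattice n) where
    open Lattice L

    private
      basis-bounds = bounds₂ basis
      β : ℝ
      β = proj₁ basis-bounds
      basis◃β : ∀ i j → basis i j ◃ β
      basis◃β = proj₂ (proj₂ basis-bounds)

    -- With `β` bounding all basis entries, this bounds each coordinate of a combination with
    -- coefficients in `[-1, 1]`.
    diameter : ℝ
    diameter = sum {n} (λ _ → β)

    diameter-nonneg : NonNeg diameter
    diameter-nonneg = ◃⇒nonneg (◃-sum {n} (λ _ → nonneg⇒◃ (proj₁ (proj₂ basis-bounds))))

    module _ {d : Vector ℝ n} where
      private
        scaled : Fin n → Vector ℝ n
        scaled i j = basis i j * d j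

        scale-out : ∀ κ j → combination κ scaled j ≈ d j * combination κ basis j
        scale-out κ j = R.trans
          (sum-cong-≋ λ i → solve 3 (λ κ b d → κ :* (b :* d) := d :* (κ :* b)) R.refl (κ i) (basis i j) (d j))
          (R.sym (*-distribˡ-sum (d j) (λ i → κ i * basis i j)))

        scaled-independent : (∀ j → Pos (d j)) → Independent scaled
        scaled-independent 0<d κ vanishing = independent κ λ j →
          *-cancel-0 (pos⇒≉0 (0<d j)) (R.trans (R.sym (scale-out κ j)) (vanishing j))

        -- Multiplied by `e`, the remainder is a combination of `scaled` whose coefficients are at
        -- most `e`; the factor `e` then cancels.
        rounded : ∀ {z : Vector ℝ n} {e κ} (m : Fin n → ℤ) → Pos e → (∀ j → Pos (d j)) →
          (∀ j → e * z j ≈ combination κ scaled j) → (∀ i → κ i + fromℤ (m i) * e ◃ e) →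
          ∀ j → z j + combination (fromℤ ∘ m) basis j * d j ◃ diameter * d j
        rounded {z} {e} {κ} m 0<e 0<d ez≈ κ+me◃e j = ◃-cancel 0<e (◃-resp expand factor
          (◃-sum λ i → ◃-* (κ+me◃e i) (◃-* (basis◃β i j) (nonneg⇒◃ (inj₁ (0<d j))))))
          where
          u : ℝ
          u = combination (fromℤ ∘ m) basis j

          expand : combination (λ i → κ i + fromℤ (m i) * e) scaled j ≈ e * (z j + u * d j)
          expand = R.trans (combination-+ κ (λ i → fromℤ (m i) * e) scaled j)
            (R.trans (R.+-cong (R.sym (ez≈ j))
              (R.trans (sum-cong-≋ λ i →
                  solve 4 (λ m e b d → m :* e :* (b :* d) := e :* d :* (m :* b)) R.refl
                    (fromℤ (m i)) e (basis i j) (d j))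
                (R.sym (*-distribˡ-sum (e * d j) (λ i → fromℤ (m i) * basis i j)))))
              (solve 4 (λ e z u d → e :* z :+ e :* d :* u := e :* (z :+ u :* d)) R.refl e (z j) u (d j)))

          factor : sum {n} (λ _ → e * (β * d j)) ≈ e * (diameter * d j)
          factor = R.trans (R.sym (*-distribˡ-sum e (λ (_ : Fin n) → β * d j)))
            (R.*-congˡ (R.sym (*-distribʳ-sum (d j) (λ (_ : Fin n) → β))))

      -- Up to the positive factor d, this is cocompactness; d is kept inside to avoid division.
      nearest-point : ∀ z → (∀ j → Pos (d j)) →
        ∃ λ u → u ∈ points × ∀ j → z j + u j * d j ◃ diameter * d j
      nearest-point z 0<d =
        let e , 0<e , κ , ez≈ = spanning (scaled-independent 0<d) z
            m = λ i → proj₁ (round 0<e (κ i))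
        in combination (fromℤ ∘ m) basis ,
           Equivalence.from (spanned _) (m , λ _ → R.refl) ,
           rounded m 0<e 0<d ez≈ (λ i → proj₂ (round 0<e (κ i)))

    -- Dirichlet's box principle applied to the (N+1)ⁿ lattice points with coordinates in [0,N].
    dirichlet : ∀ {r} (σ : Fin r → Fin n) m .{{_ : ℕ.NonZero m}} N → m ℕ.^ r ℕ.< suc N ℕ.^ n →
      ∃ λ x → x ∈ points × (¬ ∀ j → x j ≈ 0ℝ) ×
        (∀ j → x j ◃ (diameter + diameter) * ι N) ×
        (∀ i → ι m * x (σ i) ◃ (diameter + diameter) * ι N)
    dirichlet {r} σ m N m^r<N^n =
      x , Equivalence.from (spanned x) (difference , λ _ → R.refl) , x≉0 ,
      (λ j → ◃-resp (R.sym (x≈ j)) double (◃-+ (point◃ k j) (◃-neg (point◃ l j)))) ,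
      (λ i → ◃-resp (R.trans (solve 3 (λ m p q → m :* p :- m :* q := m :* (p :- q)) R.refl
                                (ι m) (point k (σ i)) (point l (σ i)))
                      (R.*-congˡ (R.sym (x≈ (σ i)))))
               double (proj₂ (proj₂ (proj₂ boxes)) i))
      where
      digit : Fin (suc N ℕ.^ n) → Fin n → Fin (suc N)
      digit = finToFun

      coefficient : Fin (suc N ℕ.^ n) → Fin n → ℤ
      coefficient k i = + toℕ (digit k i)

      point : Fin (suc N ℕ.^ n) → Vector ℝ n
      point k = combination (fromℤ ∘ coefficient k) basis

      point◃ : ∀ k j → point k j ◃ diameter * ι N
      point◃ k j = ◃-resp R.refl (R.sym (*-distribʳ-sum (ι N) (λ (_ : Fin n) → β)))
        (◃-sum λ i → ◃-resp (R.*-comm (basis i j) _) R.refl (◃-* (basis◃β i j)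
          (◃-respˡ (ι-fromℤ _) (◃-weaken (nonneg⇒◃ (ι-nonneg (toℕ (digit k i))))
            (ι-mono (ℕ.s≤s⁻¹ (Fin.toℕ<n (digit k i))))))))

      -- Only the coordinates selected by `σ` are boxed. Multiplying them by `m` turns boxes of side
      -- `2w/m` into boxes of side `2w`.
      boxes = box-pigeonhole m (nonneg-* diameter-nonneg (ι-nonneg N)) m^r<N^n
        (λ k i → ι m * point k (σ i))
        (λ k i → ◃-* (nonneg⇒◃ (ι-nonneg m)) (point◃ k (σ i)))
      k = proj₁ boxes
      l = proj₁ (proj₂ boxes)
      k<l = proj₁ (proj₂ (proj₂ boxes))

      difference : Fin n → ℤ
      difference i = coefficient k i ℤ.- coefficient l i

      x : Vector ℝ n
      x = combination (fromℤ ∘ difference) basis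

      x≈ : ∀ j → x j ≈ point k j - point l j
      x≈ j = R.trans (sum-cong-≋ λ i → R.*-congʳ (fromℤ-- (coefficient k i) (coefficient l i)))
        (R.trans (combination-+ (fromℤ ∘ coefficient k) (λ i → - fromℤ (coefficient l i)) basis j)
          (R.+-congˡ (combination-neg (fromℤ ∘ coefficient l) basis j)))

      double : diameter * ι N + diameter * ι N ≈ (diameter + diameter) * ι N
      double = R.sym (R.distribʳ (ι N) diameter diameter)

      -- Digits determine the index, and independence of the basis recovers the digits from the
      -- point.
      x≉0 : ¬ ∀ j → x j ≈ 0ℝ
      x≉0 x≈0 = Fin.<⇒≢ k<l (≡.trans (≡.sym (Fin.funToFin-finToFin {n} {suc N} k))
        (≡.trans (funToFin-cong {n} same) (Fin.funToFin-finToFin {n} {suc N} l)))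
        where
        open GroupProperties (AbelianGroup.group ℤ.+-0-abelianGroup) using (x∙y⁻¹≈ε⇒x≈y)
        same : ∀ i → digit k i ≡ digit l i
        same i = Fin.toℕ-injective (ℤ.+-injective (x∙y⁻¹≈ε⇒x≈y _ _
          (fromℤ-injective (independent (fromℤ ∘ difference) x≈0 i))))
        funToFin-cong : ∀ {m n} {f g : Fin m → Fin n} → (∀ i → f i ≡ g i) → funToFin f ≡ funToFin g
        funToFin-cong {zero}  f≗g = ≡.refl
        funToFin-cong {suc m} f≗g = ≡.cong₂ Fin.combine (f≗g zero) (funToFin-cong (f≗g ∘ suc))

-- The entries of the reduced commutator

module Matrices where

  -- Symbolic counterparts of the operations on `SL₂`, so that the ring solver meets the unfolded
  -- entries of a long product without their being written out.
  Matrix : ℕ → Set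
  Matrix m = Polynomial m × Polynomial m × Polynomial m × Polynomial m

  infixr 7 _⊗_

  _⊗_ : ∀ {m} → Matrix m → Matrix m → Matrix m
  (p , q , r , s) ⊗ (p′ , q′ , r′ , s′) =
    p :* p′ :+ q :* r′ , p :* q′ :+ q :* s′ , r :* p′ :+ s :* r′ , r :* q′ :+ s :* s′

  adjugate : ∀ {m} → Matrix m → Matrix m
  adjugate (p , q , r , s) = s , :- q , :- r , p

  Tₚ Vₚ : ∀ {m} → Polynomial m → Matrix m
  Tₚ x = con 1ℚ , x , con 0ℚ , con 1ℚ
  Vₚ x = con 1ℚ , con 0ℚ , x , con 1ℚ

  -- The last factor `Tₚ (con 0ℚ)` is the identity matrix with which the canonical fold ends.
  commutator : ∀ {m} (u v x w : Polynomial m) → Matrix m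
  commutator u v x w =
    Tₚ u ⊗ Vₚ v ⊗ Tₚ x ⊗ adjugate (Vₚ v) ⊗ adjugate (Tₚ x) ⊗ Vₚ w ⊗ Tₚ (con 0ℚ)

  entry-a entry-b entry-c entry-d : ∀ {m} → Matrix m → Polynomial m
  entry-a (p , _ , _ , _) = p
  entry-b (_ , q , _ , _) = q
  entry-c (_ , _ , r , _) = r
  entry-d (_ , _ , _ , s) = s

disc : ℝ → ℝ
disc s = 1ℝ + s + s * s

-- T^u [V^v, T^x] V^w in one coordinate, bracketed as the canonical homomorphism does.
product : (u v x w : ℝ) → SL₂
product u v x w = T₁ u *ₛ (V₁ v *ₛ (T₁ x *ₛ (V₁ v ⁻¹ₛ *ₛ (T₁ x ⁻¹ₛ *ₛ (V₁ w *ₛ 1ₛ)))))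
  where
  T₁ V₁ : ℝ → SL₂
  T₁ x = T {1} (λ _ → x) zero
  V₁ x = V {1} (λ _ → x) zero

module _ (u v x w : ℝ) where
  open Matrices

  -- The left factor adds `u` times the bottom row to the top row, and the right factor adds `w`
  -- times the right column to the left one. Hence `u` acts on `b`, `w` on `c`, both through the
  -- unchanged `d`.
  product-b : b (product u v x w) ≈ v * x * x + u * disc (v * x)
  product-b = solve 4 (λ u v x w → entry-b (commutator u v x w)
    := v :* x :* x :+ u :* (con 1ℚ :+ v :* x :+ v :* x :* (v :* x))) R.refl u v x w

  product-c : c (product u v x w) ≈ - (v * x * v) + w * disc (v * x)
  product-c = solve 4 (λ u v x w → entry-c (commutator u v x w)
    := :- (v :* x :* v) :+ w :* (con 1ℚ :+ v :* x :+ v :* x :* (v :* x))) R.refl u v x w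

  product-d : d (product u v x w) ≈ disc (v * x)
  product-d = solve 4 (λ u v x w → entry-d (commutator u v x w)
    := con 1ℚ :+ v :* x :+ v :* x :* (v :* x)) R.refl u v x w

entry : Fin 4 → SL₂ → ℝ
entry zero                   = a
entry (suc zero)             = b
entry (suc (suc zero))       = c
entry (suc (suc (suc zero))) = d

-- Uniform bounds on the reduced commutators

module Proof (em : ExcludedMiddle 0ℓ) where
  open Ordered em
  open Lattices em

  -- A sum-of-squares certificate for `2 disc s ≥ 1`, which is all that the bound on `a` uses.
  2disc : ∀ s → (1ℝ + s) * (1ℝ + s) + s * s + 1ℝ ≈ (1ℝ + 1ℝ) * disc s
  2disc = solve 1 (λ s → (con 1ℚ :+ s) :* (con 1ℚ :+ s) :+ s :* s :+ con 1ℚ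
    := (con 1ℚ :+ con 1ℚ) :* (con 1ℚ :+ s :+ s :* s)) R.refl

  squares-nonneg : ∀ s → NonNeg ((1ℝ + s) * (1ℝ + s) + s * s)
  squares-nonneg s = nonneg-+ (square-nonneg (1ℝ + s)) (square-nonneg s)

  disc-pos : ∀ s → Pos (disc s)
  disc-pos s = pos-cancel pos-2 (pos-resp (R.trans (R.+-comm _ _) (2disc s))
    (pos+nonneg pos-1 (squares-nonneg s)))

  disc◃ : ∀ {s S} → s ◃ S → disc s ◃ disc S
  disc◃ s◃S = ◃-+ (◃-+ 1◃1 s◃S) (◃-* s◃S s◃S)

  ◃-trans : ∀ {x p q} → x ◃ p → p ◃ q → x ◃ q
  ◃-trans x◃p p◃q = ◃-weaken x◃p (_◃_.upper p◃q)

  entries-bounded : ∀ S β₁ β₂ → NonNeg β₁ → NonNeg β₂ → ∃ λ M → ∀ {u v x w} → v * x ◃ S →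
    v * x * x + u * disc (v * x) ◃ β₁ * disc (v * x) →
    - (v * x * v) + w * disc (v * x) ◃ β₂ * disc (v * x) →
    ∀ i → entry i (product u v x w) ◃ M
  entries-bounded S β₁ β₂ 0≤β₁ 0≤β₂ = M , λ {u} {v} {x} {w} s◃S b◃ c◃ →
    let s   = v * x
        g   = product u v x w
        d◃D : d g ◃ D
        d◃D = ◃-respˡ (R.sym (product-d u v x w)) (disc◃ s◃S)
        b◃B : b g ◃ B
        b◃B = ◃-respˡ (R.sym (product-b u v x w)) (◃-trans b◃ (◃-* (nonneg⇒◃ 0≤β₁) (disc◃ s◃S)))
        c◃C : c g ◃ C
        c◃C = ◃-respˡ (R.sym (product-c u v x w)) (◃-trans c◃ (◃-* (nonneg⇒◃ 0≤β₂) (disc◃ s◃S)))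
        1+bc◃K : 1ℝ + b g * c g ◃ K
        1+bc◃K = ◃-+ 1◃1 (◃-* b◃B c◃C)
        disc*a : 1ℝ + b g * c g ≈ disc s * a g
        disc*a = R.trans (R.+-congʳ (R.sym (det≈1 g)))
          (R.trans (solve 4 (λ a b c d → a :* d :- b :* c :+ b :* c := d :* a) R.refl (a g) (b g) (c g) (d g))
            (R.*-congʳ (product-d u v x w)))
        -- From `disc s * a = 1 + b c` and `2 disc s ≥ 1`: a bound `K` on the product gives `2K` for
        -- `a`.
        a◃2K : a g ◃ K + K
        a◃2K = ◃-cancel (disc-pos s) (◃-respˡ disc*a (◃-weaken 1+bc◃K
          (nonneg-resp
            (R.trans (solve 2 (λ q k → q :* k := (q :+ con 1ℚ) :* k :- k) R.refl ((1ℝ + s) * (1ℝ + s) + s * s) K)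
              (R.+-congʳ (R.trans (R.*-congʳ (2disc s))
                (solve 2 (λ q k → (con 1ℚ :+ con 1ℚ) :* q :* k := q :* (k :+ k)) R.refl (disc s) K))))
            (nonneg-* (squares-nonneg s) (◃⇒nonneg 1+bc◃K)))))
    in λ where
      zero                   → ◃-trans a◃2K (◃M zero)
      (suc zero)             → ◃-trans b◃B (◃M (suc zero))
      (suc (suc zero))       → ◃-trans c◃C (◃M (suc (suc zero)))
      (suc (suc (suc zero))) → ◃-trans d◃D (◃M (suc (suc (suc zero))))
    where
    D B C K : ℝ
    D = disc S
    B = β₁ * D
    C = β₂ * D
    K = 1ℝ + B * C

    f : Vector ℝ 4
    f zero                   = K + K
    f (suc zero)             = B
    f (suc (suc zero))       = C
    f (suc (suc (suc zero))) = D

    M : ℝ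
    M = proj₁ (bounds f)
    ◃M : ∀ i → f i ◃ M
    ◃M = proj₂ (proj₂ (bounds f))

  -- Bounded sequences in a discrete subgroup

  -- If `Λ M` times each entry difference is at most `2ε`, then an entry of `1 - g⁻¹h`, a sum of two
  -- products with factors at most `M`, is at most `4Mε / (1 + 4M)`. The summand 1 makes this
  -- smaller than `ε`.
  Λ : ℝ → ℝ
  Λ M = 1ℝ + (M + M + (M + M))

  Λ-pos : ∀ {M} → NonNeg M → Pos (Λ M)
  Λ-pos 0≤M = pos+nonneg pos-1 (nonneg-+ (nonneg-+ 0≤M 0≤M) (nonneg-+ 0≤M 0≤M))

  module _ {M ε : ℝ} where

    within : ∀ {x y} → NonNeg M → Pos ε → Λ M * (x - y) ◃ M * (ε + ε) + M * (ε + ε) → Within ε x y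
    within {x} {y} 0≤M 0<ε (mk◃ l u) =
      pos⇒< (pos-cancel (Λ-pos 0≤M) (pos-resp
        (solve 4 (λ m e x y → e :+ (m :* (e :+ e) :+ m :* (e :+ e) :+ (con 1ℚ :+ (m :+ m :+ (m :+ m))) :* (x :- y))
                   := (con 1ℚ :+ (m :+ m :+ (m :+ m))) :* (x :- y :- :- e)) R.refl M ε x y)
        (pos+nonneg 0<ε l))) ,
      pos⇒< (pos-cancel (Λ-pos 0≤M) (pos-resp
        (solve 4 (λ m e x y → e :+ (m :* (e :+ e) :+ m :* (e :+ e) :- (con 1ℚ :+ (m :+ m :+ (m :+ m))) :* (x :- y))
                   := (con 1ℚ :+ (m :+ m :+ (m :+ m))) :* (e :- (x :- y))) R.refl M ε x y)
        (pos+nonneg 0<ε u)))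

    -- The entries of 1 - g⁻¹h are of the form p (g₁ - h₁) + q (g₂ - h₂), where p, q, g₁, g₂ are
    -- up to sign entries of g and h₁, h₂ the corresponding entries of h.
    quotient-within : ∀ {p q x y x′ y′ z z′} → NonNeg M → Pos ε → p ◃ M → q ◃ M →
      Λ M * x - Λ M * x′ ◃ ε + ε → Λ M * y - Λ M * y′ ◃ ε + ε →
      z - z′ ≈ p * (x - x′) + q * (y - y′) → Within ε z z′
    quotient-within {p} {q} {x} {y} {x′} {y′} 0≤M 0<ε p◃M q◃M x◃ y◃ z≈ =
      within 0≤M 0<ε (◃-respˡ
        (R.trans
          (solve 7 (λ l p q x y x′ y′ → p :* (l :* x :- l :* x′) :+ q :* (l :* y :- l :* y′)
                      := l :* (p :* (x :- x′) :+ q :* (y :- y′))) R.refl (Λ M) p q x y x′ y′)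
          (R.*-congˡ (R.sym z≈)))
        (◃-+ (◃-* p◃M x◃) (◃-* q◃M y◃)))

    quotient-close : ∀ {n} {g h : Fin n → SL₂} → NonNeg M → Pos ε →
      (∀ j i → entry i (g j) ◃ M) →
      (∀ j i → Λ M * entry i (g j) - Λ M * entry i (h j) ◃ ε + ε) →
      Close ε (λ _ → 1ₛ) (λ j → g j ⁻¹ₛ *ₛ h j)
    quotient-close {g = g} {h} 0≤M 0<ε g◃M g~h = record
      { a-close = λ j → quotient-within 0≤M 0<ε (g◃M j i₃) (◃-neg (g◃M j i₁)) (g~h j i₀) (g~h j i₂)
          -- Writing 1 as the determinant of `g j` turns `1 - g⁻¹h` into `g⁻¹(g - h)`.
          (R.trans (R.+-congʳ (R.sym (det≈1 (g j))))
            (solve 6 (λ a b c d a′ c′ → (a :* d :- b :* c) :- (d :* a′ :+ (:- b) :* c′)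
                        := d :* (a :- a′) :+ (:- b) :* (c :- c′)) R.refl
              (a (g j)) (b (g j)) (c (g j)) (d (g j)) (a (h j)) (c (h j))))
      ; b-close = λ j → quotient-within 0≤M 0<ε (g◃M j i₃) (◃-neg (g◃M j i₁)) (g~h j i₁) (g~h j i₃)
          (solve 4 (λ b d b′ d′ → con 0ℚ :- (d :* b′ :+ (:- b) :* d′)
                      := d :* (b :- b′) :+ (:- b) :* (d :- d′)) R.refl
            (b (g j)) (d (g j)) (b (h j)) (d (h j)))
      ; c-close = λ j → quotient-within 0≤M 0<ε (g◃M j i₀) (◃-neg (g◃M j i₂)) (g~h j i₂) (g~h j i₀)
          (solve 4 (λ a c a′ c′ → con 0ℚ :- ((:- c) :* a′ :+ a :* c′)
                      := a :* (c :- c′) :+ (:- c) :* (a :- a′)) R.refl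
            (a (g j)) (c (g j)) (a (h j)) (c (h j)))
      ; d-close = λ j → quotient-within 0≤M 0<ε (g◃M j i₀) (◃-neg (g◃M j i₂)) (g~h j i₃) (g~h j i₁)
          (R.trans (R.+-congʳ (R.sym (det≈1 (g j))))
            (solve 6 (λ a b c d b′ d′ → (a :* d :- b :* c) :- ((:- c) :* b′ :+ a :* d′)
                        := a :* (d :- d′) :+ (:- c) :* (b :- b′)) R.refl
              (a (g j)) (b (g j)) (c (g j)) (d (g j)) (b (h j)) (d (h j))))
      }
      where
      i₀ i₁ i₂ i₃ : Fin 4
      i₀ = zero
      i₁ = suc zero
      i₂ = suc (suc zero)
      i₃ = suc (suc (suc zero))

  module _ {n : ℕ} (S : Subgroup (G n) 0ℓ) (discrete : IsDiscrete (Subgroup.members S)) where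
    open Group (G n) using (ε; _∙_; _⁻¹; trans; sym) renaming (_≈_ to _≈G_)
    open GroupProperties (G n) using (inverseʳ-unique; ⁻¹-involutive)

    identity-isolated : ∃ λ ρ → Pos ρ × ∀ h → h ∈ Subgroup.members S → Close ρ ε h → h ≈G ε
    identity-isolated =
      let U , U-open , ε∈U , isolated = discrete ε (Subgroup.ε∈ S)
          ρ , 0<ρ , ball⊆U = IsOpen.ball U-open ε ε∈U
      in ρ , 0<ρ , λ h h∈S close → isolated h h∈S (ball⊆U h close)

    -- The isolation radius at the identity separates all elements uniformly by way of quotients,
    -- and a bounded part of `ℝ⁴ⁿ` is covered by finitely many boxes finer than this separation.
    bounded-sequence-repeats : ∀ {M} → NonNeg M → (g : ℕ → Fin n → SL₂) →
      (∀ k → g k ∈ Subgroup.members S) → (∀ k j i → entry i (g k j) ◃ M) →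
      ∃₂ λ k l → k ℕ.< l × g k ≈G g l
    bounded-sequence-repeats {M} 0≤M g g∈S g◃M =
      toℕ k , toℕ l , k<l , sym (trans (inverseʳ-unique _ _ (isolated _ h∈S h-close)) (⁻¹-involutive _))
      where
      ρ = proj₁ identity-isolated
      0<ρ = proj₁ (proj₂ identity-isolated)
      isolated = proj₂ (proj₂ identity-isolated)

      multiple = archimedes 0<ρ (Λ M * M)
      -- Chosen so that `m` cells of length `2ρ` cover the range of the scaled entries; the
      -- successor makes `m` nonzero.
      m = suc (proj₁ multiple)

      ΛM≤mρ : NonNeg (ι m * ρ - Λ M * M)
      ΛM≤mρ = nonneg-resp
        (R.trans (solve 3 (λ k r x → r :+ (k :* r :- x) := (con 1ℚ :+ k) :* r :- x) R.refl
                   (ι (proj₁ multiple)) ρ (Λ M * M))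
          (R.+-congʳ (R.*-congʳ (R.sym (ι-suc _)))))
        (nonneg-+ (inj₁ 0<ρ) (inj₁ (proj₂ multiple)))

      coordinate : Fin (suc (m ℕ.^ (4 ℕ.* n))) → Fin (4 ℕ.* n) → ℝ
      coordinate k i = Λ M * entry (proj₁ (Fin.remQuot {4} n i)) (g (toℕ k) (proj₂ (Fin.remQuot {4} n i)))

      boxes = box-pigeonhole m (inj₁ 0<ρ) (ℕ.n<1+n _) coordinate λ k i →
        ◃-weaken (◃-* (nonneg⇒◃ (inj₁ (Λ-pos 0≤M))) (g◃M (toℕ k) (proj₂ (Fin.remQuot {4} n i)) (proj₁ (Fin.remQuot {4} n i)))) ΛM≤mρ
      k = proj₁ boxes
      l = proj₁ (proj₂ boxes)
      k<l = proj₁ (proj₂ (proj₂ boxes))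

      gₖ~gₗ : ∀ j i → Λ M * entry i (g (toℕ k) j) - Λ M * entry i (g (toℕ l) j) ◃ ρ + ρ
      gₖ~gₗ j i = ≡.subst (λ ij → Λ M * entry (proj₁ ij) (g (toℕ k) (proj₂ ij))
                                   - Λ M * entry (proj₁ ij) (g (toℕ l) (proj₂ ij)) ◃ ρ + ρ)
        (Fin.remQuot-combine i j) (proj₂ (proj₂ (proj₂ boxes)) (Fin.combine i j))

      h-close : Close ρ ε (g (toℕ k) ⁻¹ ∙ g (toℕ l))
      h-close = quotient-close {M} {ρ} 0≤M 0<ρ (g◃M (toℕ k)) gₖ~gₗ

      h∈S : g (toℕ k) ⁻¹ ∙ g (toℕ l) ∈ Subgroup.members S
      h∈S = Subgroup.∙∈ S (Subgroup.⁻¹∈ S (g∈S (toℕ k))) (g∈S (toℕ l))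

  -- Infinitely many pairs with bounded products

  escape : ∀ {y} → ¬ y ≈ 0ℝ → ∀ C → ∃ λ t₀ → ∀ t → t₀ ≤ t → ¬ ι t * y ◃ C
  escape {y} y≉0 C = from-sign (pos-total y≉0)
    where
    positive : ∀ {e} → Pos e → ∃ λ t₀ → ∀ t → t₀ ≤ t → ¬ ι t * e ◃ C
    positive {e} 0<e = let N , 0<Ne-C = archimedes 0<e C in N , λ t N≤t (mk◃ _ te≤C) →
      ¬pos∧nonneg- (pos-resp
          (solve 4 (λ t N e C → (N :* e :- C) :+ (t :- N) :* e := t :* e :- C) R.refl (ι t) (ι N) e C)
          (pos+nonneg 0<Ne-C (nonneg-* (ι-mono N≤t) (inj₁ 0<e))))
        (nonneg-resp (solve 3 (λ t e C → C :- t :* e := :- (t :* e :- C)) R.refl (ι t) e C) te≤C)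

    from-sign : Pos y ⊎ Pos (- y) → ∃ λ t₀ → ∀ t → t₀ ≤ t → ¬ ι t * y ◃ C
    from-sign (inj₁ 0<y) = positive 0<y
    from-sign (inj₂ y<0) = let t₀ , large = positive y<0 in t₀ , λ t t₀≤t ty◃C →
      large t t₀≤t (◃-respˡ (solve 2 (λ t y → :- (t :* y) := t :* (:- y)) R.refl (ι t) y) (◃-neg ty◃C))

  module Pairs {n₂ : ℕ} (L₁ L₂ : Lattice (suc (suc n₂))) where
    n₁ n : ℕ
    n₁ = suc n₂
    n  = suc n₁

    C₁ C₂ : ℝ
    C₁ = diameter L₁ + diameter L₁
    C₂ = diameter L₂ + diameter L₂

    record Pair : Set where
      field
        x v      : Vector ℝ n
        x∈       : x ∈ Lattice.points L₁
        v∈       : v ∈ Lattice.points L₂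
        x≉0      : ¬ ∀ j → x j ≈ 0ℝ
        v≉0      : ¬ ∀ j → v j ≈ 0ℝ
        product◃ : ∀ j → v j * x j ◃ C₁ * C₂

    open Pair public

    -- Exactly one factor of `v j * x j` is constrained in each coordinate. A fixed pair that is
    -- small at arbitrarily large scales therefore has all these products zero.
    record Small (t : ℕ) (x v : Vector ℝ n) : Set where
      field
        x-small : ι t * x zero ◃ C₁
        v-small : ∀ i → ι t * v (suc i) ◃ C₂

    C₁-nonneg : NonNeg C₁
    C₁-nonneg = nonneg-+ (diameter-nonneg L₁) (diameter-nonneg L₁)

    -- At scale T the box for x has sides T^(1-n) in the coordinate zero and T in the others,
    -- and the box for v has the inverse sides.
    pair-at : ∀ t → Σ Pair λ π → Small (suc t) (x π) (v π)
    pair-at t = record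
      { x = proj₁ X ; v = proj₁ Y ; x∈ = proj₁ (proj₂ X) ; v∈ = proj₁ (proj₂ Y)
      ; x≉0 = proj₁ (proj₂ (proj₂ X)) ; v≉0 = proj₁ (proj₂ (proj₂ Y)) ; product◃ = bounded }
      , record { x-small = x-small ; v-small = v-small }
      where
      T₀ : ℕ
      T₀ = suc t

      instance
        T^n≢0 : ℕ.NonZero (T₀ ℕ.^ n)
        T^n≢0 = ℕ.m^n≢0 T₀ n
        T^n₂≢0 : ℕ.NonZero (T₀ ℕ.^ n₂)
        T^n₂≢0 = ℕ.m^n≢0 T₀ n₂

      -- One coordinate is cut into `Tⁿ` cells against `(T+1)ⁿ` points.
      X = dirichlet L₁ {1} (λ _ → zero) (T₀ ℕ.^ n) T₀
        (≡.subst (ℕ._< suc T₀ ℕ.^ n) (≡.sym (ℕ.*-identityʳ (T₀ ℕ.^ n))) (ℕ.^-monoˡ-< n (ℕ.n<1+n T₀)))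
      -- Cutting `n-1` coordinates into `Tⁿ` cells each gives `(Tⁿ⁻¹)ⁿ` boxes, fewer than the
      -- `(Tⁿ⁻¹+1)ⁿ` points.
      Y = dirichlet L₂ {n₁} suc (T₀ ℕ.^ n) (T₀ ℕ.^ n₁)
        (≡.subst (ℕ._< suc (T₀ ℕ.^ n₁) ℕ.^ n)
          (≡.trans (ℕ.^-*-assoc T₀ n₁ n) (≡.trans (≡.cong (T₀ ℕ.^_) (ℕ.*-comm n₁ n)) (≡.sym (ℕ.^-*-assoc T₀ n n₁))))
          (ℕ.^-monoˡ-< n (ℕ.n<1+n (T₀ ℕ.^ n₁))))

      -- Here `n ≥ 2` enters: `Tⁿ⁻¹ = τ q` with `q = Tⁿ⁻² ≥ 1`, so the coordinate zero of `x` decays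
      -- at least like `1/τ`.
      τ q : ℝ
      τ = ι T₀
      q = ι (T₀ ℕ.^ n₂)

      0<τ : Pos τ
      0<τ = ι-pos t
      ι-positive : ∀ m .{{_ : ℕ.NonZero m}} → Pos (ι m)
      ι-positive (suc m) = ι-pos m
      0<q : Pos q
      0<q = ι-positive (T₀ ℕ.^ n₂)

      ι-T^n₁ : ι (T₀ ℕ.^ n₁) ≈ τ * q
      ι-T^n₁ = ι-* T₀ (T₀ ℕ.^ n₂)
      ι-T^n : ι (T₀ ℕ.^ n) ≈ τ * (τ * q)
      ι-T^n = R.trans (ι-* T₀ (T₀ ℕ.^ n₁)) (R.*-congˡ ι-T^n₁)

      x◃ : ∀ j → proj₁ X j ◃ C₁ * τ
      x◃ = proj₁ (proj₂ (proj₂ (proj₂ X)))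
      x₀◃ : τ * (τ * q) * proj₁ X zero ◃ C₁ * τ
      x₀◃ = ◃-respˡ (R.*-congʳ ι-T^n) (proj₂ (proj₂ (proj₂ (proj₂ X))) zero)
      v◃ : ∀ j → proj₁ Y j ◃ C₂ * (τ * q)
      v◃ j = ◃-resp R.refl (R.*-congˡ ι-T^n₁) (proj₁ (proj₂ (proj₂ (proj₂ Y))) j)
      vᵢ◃ : ∀ i → τ * (τ * q) * proj₁ Y (suc i) ◃ C₂ * (τ * q)
      vᵢ◃ i = ◃-resp (R.*-congʳ ι-T^n) (R.*-congˡ ι-T^n₁) (proj₂ (proj₂ (proj₂ (proj₂ Y))) i)

      bounded : ∀ j → proj₁ Y j * proj₁ X j ◃ C₁ * C₂
      bounded zero = ◃-cancel (pos-* 0<τ (pos-* 0<τ 0<q)) (◃-resp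
        (solve 4 (λ t q x v → v :* (t :* (t :* q) :* x) := t :* (t :* q) :* (v :* x)) R.refl τ q (proj₁ X zero) (proj₁ Y zero))
        (solve 4 (λ t q c d → d :* (t :* q) :* (c :* t) := t :* (t :* q) :* (c :* d)) R.refl τ q C₁ C₂)
        (◃-* (v◃ zero) x₀◃))
      bounded (suc i) = ◃-cancel (pos-* 0<τ (pos-* 0<τ 0<q)) (◃-resp
        (solve 4 (λ t q x v → t :* (t :* q) :* v :* x := t :* (t :* q) :* (v :* x)) R.refl τ q (proj₁ X (suc i)) (proj₁ Y (suc i)))
        (solve 4 (λ t q c d → d :* (t :* q) :* (c :* t) := t :* (t :* q) :* (c :* d)) R.refl τ q C₁ C₂)
        (◃-* (vᵢ◃ i) (x◃ (suc i))))

      x-small : τ * proj₁ X zero ◃ C₁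
      x-small = ◃-cancel (pos-* 0<τ 0<q) (◃-resp
        (solve 3 (λ t q x → t :* (t :* q) :* x := t :* q :* (t :* x)) R.refl τ q (proj₁ X zero)) R.refl
        (◃-weaken x₀◃ (nonneg-resp
          (solve 3 (λ c t q → c :* t :* (q :- con 1ℚ) := t :* q :* c :- c :* t) R.refl C₁ τ q)
          (nonneg-* (nonneg-* C₁-nonneg (inj₁ 0<τ))
            (nonneg-resp (R.+-congˡ (R.-‿cong ι-1)) (ι-mono (ℕ.>-nonZero⁻¹ (T₀ ℕ.^ n₂))))))))

      v-small : ∀ i → τ * proj₁ Y (suc i) ◃ C₂
      v-small i = ◃-cancel (pos-* 0<τ 0<q) (◃-resp
        (solve 3 (λ t q v → t :* (t :* q) :* v := t :* q :* (t :* v)) R.refl τ q (proj₁ Y (suc i)))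
        (solve 3 (λ c t q → c :* (t :* q) := t :* q :* c) R.refl C₂ τ q)
        (vᵢ◃ i))

    not-small : ∀ π → (¬ ∀ j → v π j * x π j ≈ 0ℝ) → ∃ λ t₀ → ∀ t → t₀ ≤ t → ¬ Small t (x π) (v π)
    not-small π vx≉0 with em {x π zero ≈ 0ℝ} | em {∃ λ i → ¬ v π (suc i) ≈ 0ℝ}
    ... | no x₀≉0  | _ = let t₀ , large = escape x₀≉0 C₁ in
      t₀ , λ t t₀≤t small → large t t₀≤t (Small.x-small small)
    ... | yes _    | yes (i , vᵢ≉0) = let t₀ , large = escape vᵢ≉0 C₂ in
      t₀ , λ t t₀≤t small → large t t₀≤t (Small.v-small small i)
    ... | yes x₀≈0 | no v≈0 = contradiction vanishing vx≉0
      where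
      vanishing : ∀ j → v π j * x π j ≈ 0ℝ
      vanishing zero    = R.trans (R.*-congˡ x₀≈0) (R.zeroʳ _)
      vanishing (suc i) = R.trans (R.*-congʳ (decidable-stable em λ vᵢ≉0 → v≈0 (i , vᵢ≉0))) (R.zeroˡ _)

    small-resp : ∀ {t x y v w} → (∀ j → x j ≈ y j) → (∀ j → v j ≈ w j) → Small t x v → Small t y w
    small-resp x≈y v≈w small = record
      { x-small = ◃-respˡ (R.*-congˡ (x≈y zero)) (Small.x-small small)
      ; v-small = λ i → ◃-respˡ (R.*-congˡ (v≈w (suc i))) (Small.v-small small i)
      }

    -- pair-at is a parameter so that its value is not unfolded.
    module Sequence (pair-at : ∀ t → Σ Pair λ π → Small (suc t) (x π) (v π))
                    (non-commuting : ∀ π → ¬ ∀ j → v π j * x π j ≈ 0ℝ) where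

      threshold : ℕ → ℕ
      threshold t = proj₁ (not-small (proj₁ (pair-at t)) (non-commuting (proj₁ (pair-at t))))

      -- Each new scale passes the threshold after which the preceding pair is no longer small, so
      -- no later pair can equal it.
      time : ℕ → ℕ
      time zero    = 0
      time (suc k) = time k ℕ.⊔ threshold (time k)

      pair : ℕ → Pair
      pair k = proj₁ (pair-at (time k))

      time-mono : ∀ {k l} → k ℕ.≤′ l → time k ≤ time l
      time-mono ℕ.≤′-refl        = ℕ.≤-refl
      time-mono (ℕ.≤′-step k≤l) = ℕ.≤-trans (time-mono k≤l) (ℕ.m≤m⊔n _ _)

      pair-injective : ∀ {k l} → k ℕ.< l → (∀ j → x (pair k) j ≈ x (pair l) j) →
        ¬ ∀ j → v (pair k) j ≈ v (pair l) j
      pair-injective {k} {l} k<l x≈ v≈ =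
        -- The pair found at `time l` is small at scale `suc (time l)`.
        proj₂ (not-small (pair k) (non-commuting (pair k))) (suc (time l))
          (ℕ.≤-trans (ℕ.m≤n⊔m (time k) (threshold (time k)))
            (ℕ.≤-trans (time-mono (ℕ.≤⇒≤′ k<l)) (ℕ.n≤1+n (time l))))
          (small-resp (R.sym ∘ x≈) (R.sym ∘ v≈) (proj₂ (pair-at (time l))))

  -- Consequences of freeness and the contradiction

  -- The sign ambiguity of `PSL₂` disappears when both upper left entries are 1, since `1 = -1` is
  -- impossible.
  T-entry : ∀ {x A} → T {1} (λ _ → x) zero ≈ₚ A → a A ≈ 1ℝ → x ≈ b A
  T-entry (inj₁ T≈A)  a≈1 = _≈ₛ_.b≈ T≈A
  T-entry (inj₂ T≈-A) a≈1 = contradiction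
    (R.trans (R.+-congʳ (R.trans (_≈ₛ_.a≈ T≈-A) (R.-‿cong a≈1))) (R.-‿inverseˡ 1ℝ)) (pos⇒≉0 pos-2)

  V-entry : ∀ {x A} → V {1} (λ _ → x) zero ≈ₚ A → a A ≈ 1ℝ → x ≈ c A
  V-entry (inj₁ V≈A)  a≈1 = _≈ₛ_.c≈ V≈A
  V-entry (inj₂ V≈-A) a≈1 = contradiction
    (R.trans (R.+-congʳ (R.trans (_≈ₛ_.a≈ V≈-A) (R.-‿cong a≈1))) (R.-‿inverseˡ 1ℝ)) (pos⇒≉0 pos-2)

  -- The two products differ only on the diagonal, and there by `v x`. The factors `1ₛ` come from
  -- the canonical fold.
  commuting : ∀ {v x} → v * x ≈ 0ℝ →
    V {1} (λ _ → v) zero *ₛ (T {1} (λ _ → x) zero *ₛ 1ₛ) ≈ₛ T {1} (λ _ → x) zero *ₛ (V {1} (λ _ → v) zero *ₛ 1ₛ)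
  commuting {v} {x} vx≈0 = mk≈ₛ
    (R.trans (R.sym (R.trans (R.+-congˡ vx≈0) (R.+-identityʳ _)))
      (solve 2 (λ v x → entry-a (Vₚ v ⊗ Tₚ x ⊗ Tₚ (con 0ℚ)) :+ v :* x
                          := entry-a (Tₚ x ⊗ Vₚ v ⊗ Tₚ (con 0ℚ))) R.refl v x))
    (solve 2 (λ v x → entry-b (Vₚ v ⊗ Tₚ x ⊗ Tₚ (con 0ℚ))
                        := entry-b (Tₚ x ⊗ Vₚ v ⊗ Tₚ (con 0ℚ))) R.refl v x)
    (solve 2 (λ v x → entry-c (Vₚ v ⊗ Tₚ x ⊗ Tₚ (con 0ℚ))
                        := entry-c (Tₚ x ⊗ Vₚ v ⊗ Tₚ (con 0ℚ))) R.refl v x)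
    (R.trans (solve 2 (λ v x → entry-d (Vₚ v ⊗ Tₚ x ⊗ Tₚ (con 0ℚ))
                                 := entry-d (Tₚ x ⊗ Vₚ v ⊗ Tₚ (con 0ℚ)) :+ v :* x) R.refl v x)
      (R.trans (R.+-congˡ vx≈0) (R.+-identityʳ _)))
    where open Matrices

  module Freeness {n₂ : ℕ} (L₁ L₂ : Lattice (suc (suc n₂))) (free : IsFreeInnerProduct (Γupp L₁) (Γlow L₂)) where
    open Pairs L₁ L₂
    open Canonical (Γupp L₁) (Γlow L₂) using (canonical)

    private
      A B : Group 0ℓ 0ℓ
      A = Subgroup.group (Γupp L₁)
      B = Subgroup.group (Γlow L₂)

    open NormalForm A B (λ _ _ → em) (λ _ _ → em)

    upperˡ : ∀ {x} → x ∈ Lattice.points L₁ → Group.Carrier A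
    upperˡ {x} x∈ = T x , x , x∈ , Group.refl (G n)

    lowerˡ : ∀ {y} → y ∈ Lattice.points L₂ → Group.Carrier B
    lowerˡ {y} y∈ = V y , y , y∈ , Group.refl (G n)

    upper≉ε : ∀ {x} (x∈ : x ∈ Lattice.points L₁) → (¬ ∀ j → x j ≈ 0ℝ) → ¬ Group._≈_ A (upperˡ x∈) (Group.ε A)
    upper≉ε x∈ x≉0 T≈ε = x≉0 λ j → T-entry (T≈ε j) R.refl

    lower≉ε : ∀ {y} (y∈ : y ∈ Lattice.points L₂) → (¬ ∀ j → y j ≈ 0ℝ) → ¬ Group._≈_ B (lowerˡ y∈) (Group.ε B)
    lower≉ε y∈ y≉0 V≈ε = y≉0 λ j → V-entry (V≈ε j) R.refl

    open FreeProduct A B using (Word; _∼_)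

    canonical-injective : ∀ u v → Group._≈_ (G n) (proj₁ (canonical u)) (proj₁ (canonical v)) → u ∼ v
    canonical-injective u v = IsGroupIsomorphism.injective free {u} {v}

    non-commuting : ∀ π → ¬ ∀ j → v π j * x π j ≈ 0ℝ
    non-commuting π vx≈0 = not-commuting {lowerˡ (v∈ π)} {upperˡ (x∈ π)}
      (lower≉ε (v∈ π) (v≉0 π)) (upper≉ε (x∈ π) (x≉0 π))
      (canonical-injective _ _ λ j → inj₁ (commuting {v π j} {x π j} (vx≈0 j)))

    word : Pair → ∀ {u w} → u ∈ Lattice.points L₁ → w ∈ Lattice.points L₂ → Word
    word π u∈ w∈ = twisted-commutator (upperˡ u∈) (lowerˡ (v∈ π)) (upperˡ (x∈ π)) (lowerˡ w∈)

    word-injective : ∀ π π′ {u w u′ w′} (u∈ : u ∈ Lattice.points L₁) (w∈ : w ∈ Lattice.points L₂)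
      (u′∈ : u′ ∈ Lattice.points L₁) (w′∈ : w′ ∈ Lattice.points L₂) →
      Group._≈_ (G n) (proj₁ (canonical (word π u∈ w∈))) (proj₁ (canonical (word π′ u′∈ w′∈))) →
      (∀ j → x π j ≈ x π′ j) × (∀ j → v π j ≈ v π′ j)
    word-injective π π′ u∈ w∈ u′∈ w′∈ eq =
      (λ j → T-entry {x π j} {T (x π′) j} (proj₁ letters j) R.refl) ,
      (λ j → V-entry {v π j} {V (v π′) j} (proj₂ letters j) R.refl)
      where
      same : word π u∈ w∈ ∼ word π′ u′∈ w′∈
      same = canonical-injective (word π u∈ w∈) (word π′ u′∈ w′∈) eq
      letters : Group._≈_ A (upperˡ (x∈ π)) (upperˡ (x∈ π′)) × Group._≈_ B (lowerˡ (v∈ π)) (lowerˡ (v∈ π′))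
      letters = twisted-commutator-injective {upperˡ u∈} {upperˡ u′∈} {lowerˡ (v∈ π)} {lowerˡ (v∈ π′)}
            {upperˡ (x∈ π)} {upperˡ (x∈ π′)} {lowerˡ w∈} {lowerˡ w′∈}
            (lower≉ε (v∈ π) (v≉0 π)) (lower≉ε (v∈ π′) (v≉0 π′))
            (upper≉ε (x∈ π) (x≉0 π)) (upper≉ε (x∈ π′) (x≉0 π′)) same

    Δ : Pair → Vector ℝ n
    Δ π j = disc (v π j * x π j)

    reduce-upper : ∀ π → ∃ λ u → u ∈ Lattice.points L₁ ×
      ∀ j → v π j * x π j * x π j + u j * Δ π j ◃ diameter L₁ * Δ π j
    reduce-upper π = nearest-point L₁ (λ j → v π j * x π j * x π j) (λ j → disc-pos (v π j * x π j))

    reduce-lower : ∀ π → ∃ λ w → w ∈ Lattice.points L₂ ×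
      ∀ j → - (v π j * x π j * v π j) + w j * Δ π j ◃ diameter L₂ * Δ π j
    reduce-lower π = nearest-point L₂ (λ j → - (v π j * x π j * v π j)) (λ j → disc-pos (v π j * x π j))

    reduced-word : Pair → Word
    reduced-word π = word π (proj₁ (proj₂ (reduce-upper π))) (proj₁ (proj₂ (reduce-lower π)))

    element : Pair → Group.Carrier (G n)
    element π = proj₁ (canonical (reduced-word π))

    bound-M = entries-bounded (C₁ * C₂) (diameter L₁) (diameter L₂) (diameter-nonneg L₁) (diameter-nonneg L₂)

    -- In each coordinate the canonical image of the word unfolds to `product`, so the matrix bound
    -- applies directly.
    element-bounded : ∀ π j i → entry i (element π j) ◃ proj₁ bound-M
    element-bounded π j i = proj₂ bound-M (product◃ π j)
      (proj₂ (proj₂ (reduce-upper π)) j) (proj₂ (proj₂ (reduce-lower π)) j) i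

    element-injective : ∀ π π′ → Group._≈_ (G n) (element π) (element π′) →
      (∀ j → x π j ≈ x π′ j) × (∀ j → v π j ≈ v π′ j)
    element-injective π π′ = word-injective π π′
      (proj₁ (proj₂ (reduce-upper π))) (proj₁ (proj₂ (reduce-lower π)))
      (proj₁ (proj₂ (reduce-upper π′))) (proj₁ (proj₂ (reduce-lower π′)))

    pairs-repeat : IsDiscrete (Subgroup.members (Γ L₁ L₂)) → (pair : ℕ → Pair) →
      ∃₂ λ k l → k ℕ.< l × (∀ j → x (pair k) j ≈ x (pair l) j) × (∀ j → v (pair k) j ≈ v (pair l) j)
    pairs-repeat discrete pair =
      let k , l , k<l , eq = bounded-sequence-repeats (Γ L₁ L₂) discrete
            (◃⇒nonneg (element-bounded (pair 0) zero zero)) (λ k → element (pair k))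
            (λ k → proj₂ (canonical (reduced-word (pair k)))) (λ k → element-bounded (pair k))
      in k , l , k<l , element-injective (pair k) (pair l) eq

    not-discrete : ¬ IsDiscrete (Subgroup.members (Γ L₁ L₂))
    not-discrete discrete =
      let k , l , k<l , x≈ , v≈ = pairs-repeat discrete pair
      in pair-injective {k} {l} k<l x≈ v≈
      where open Sequence pair-at non-commuting

proposition4p3 : ExcludedMiddle 0ℓ →
    (n : ℕ) → 2 ≤ n →
    (L₁ L₂ : Lattice n) →
    IsDiscrete (Subgroup.members (Γ L₁ L₂)) →
    ¬ IsFreeInnerProduct (Γupp L₁) (Γlow L₂)
proposition4p3 em _ (s≤s (s≤s z≤n)) L₁ L₂ discrete free = not-discrete discrete
  where
  open Proof em
  open Freeness L₁ L₂ free
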